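{- Let $f_1,\dots,f_m$ be rational linear forms on $\mathbb{R}^d$ of constant positive weight ($f_1(\mathbf 1)=\cdots=f_m(\mathbf 1)>0$, $\mathbf 1=(1,\dots,1)$), such that every variable appears in at least one form and $f_1(x)=\cdots=f_m(x)=1$ is consistent; let $s$ be its solution space, $\mathcal O:=\mathbb{R}^d_{\ge0}$, $P:=s\cap\mathcal O$, and $\mathcal{H}:=\{h_{jk}\cap s : h_{jk}\not\supseteq s\}$ where $h_{jk}$ is the hyperplane $x_j=x_k$. Assume a magic labelling exists, i.e. an integer point $x$ with distinct positive coordinates and $f_1(x)=\cdots=f_m(x)$. Let $A^\circ(t)$ be the number of integer points of $tP$ with distinct positive entries and $A(t)$ the number of pairs $(x,\sigma)$ with $x$ a nonnegative integer point of $tP$ and $\sigma$ a permutation of $[d]$ compatible with $x$ and realizable in $P^\circ$. Then $$A^\circ(t)=\sum_{u\in\mathcal{L}(P^\circ,\mathcal{H})}\mu(\hat0,u)\,E_{u\cap\mathcal O^\circ}(t),\qquad A(t)=\sum_{u\in\mathcal{L}(P^\circ,\mathcal{H})}|\mu(\hat0,u)|\,E_{u\cap\mathcal O}(t),$$ where $\mu$ is the Möbius function of $\mathcal{L}(P^\circ,\mathcal{H})$.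
   Context: $\mathcal O^\circ$ is the open positive orthant and $P^\circ$ the relative interior of $P$. $\mathcal{L}(P^\circ,\mathcal{H}) := \{P^\circ\cap\bigcap\mathcal S:\mathcal S\subseteq\mathcal H\}\setminus\{\emptyset\}$ ordered by reverse inclusion, with bottom $\hat0=P^\circ$. For a member $u$, $E_{Q\cap u}(t)$ is the number of integer points in $t(Q\cap\bar u)$, where $\bar u=\bigcap\mathcal S\subseteq s$ is the flat whose intersection with $P^\circ$ is $u$. Möbius function: $\mu(r,r)=1$, $\mu(r,s)=-\sum_{r\le w<s}\mu(r,w)$ for $r<s$. A point realizes permutation $\tau$ if $x_{\tau1}<\cdots<x_{\tau d}$; compatible means $x_{\sigma1}\le\cdots\le x_{\sigma d}$. -}

module Defs where

open import Data.Nat as ℕ using (ℕ; zero; suc)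
open import Data.Integer as ℤ using (ℤ; +_)
open import Data.Rational as ℚ using (ℚ; 0ℚ; 1ℚ; _/_)
open import Data.Fin as Fin using (Fin; toℕ)
open import Data.Vec using (Vec; lookup; zipWith; foldr; map; replicate)
open import Data.List using (List; length)
open import Data.List.Relation.Unary.All using (All)
open import Data.List.Relation.Unary.Unique.Propositional using (Unique)
open import Data.List.Membership.Propositional using (_∈_)
open import Data.Product using (Σ; ∃; _×_; _,_)
open import Data.Bool using (Bool; true; false; _∧_; not; if_then_else_)
open import Relation.Nullary using (¬_; does)
open import Relation.Binary.PropositionalEquality using (_≡_; _≢_)
open import Function.Bundles using (_⇔_)

Σℤ : (n : ℕ) → (Fin n → ℤ) → ℤ
Σℤ zero    f = + 0
Σℤ (suc n) f = f Fin.zero ℤ.+ Σℤ n (λ i → f (Fin.suc i))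

Σℕ : (n : ℕ) → (Fin n → ℕ) → ℕ
Σℕ zero    f = 0
Σℕ (suc n) f = f Fin.zero ℕ.+ Σℕ n (λ i → f (Fin.suc i))

HasCard : {A : Set} → (A → Set) → ℕ → Set
HasCard {A} P n =
  Σ (List A) λ xs → Unique xs × (∀ a → (a ∈ xs) ⇔ P a) × length xs ≡ n

Form : ℕ → Set
Form d = Vec ℚ d

System : ℕ → ℕ → Set
System d m = Fin m → Form d

evalF : ∀ {d} → Form d → Vec ℚ d → ℚ
evalF a y = foldr _ ℚ._+_ 0ℚ (zipWith ℚ._*_ a y)

ℕtoℚ : ℕ → ℚ
ℕtoℚ n = (+ n) / 1

vecℕtoℚ : ∀ {d} → Vec ℕ d → Vec ℚ d
vecℕtoℚ = map ℕtoℚ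

ones : ∀ {d} → Vec ℚ d
ones = replicate _ 1ℚ

InS : ∀ {d m} → System d m → Vec ℚ d → Set
InS F y = ∀ i → evalF (F i) y ≡ 1ℚ

InPo : ∀ {d m} → System d m → Vec ℚ d → Set
InPo F y = InS F y × (∀ j → 0ℚ ℚ.< lookup y j)

Pair : ℕ → Set
Pair d = Fin d × Fin d

-- h_jk ∩ s ∈ ℋ, i.e. h_jk does not contain s
InH : ∀ {d m} → System d m → Pair d → Set
InH F (j , k) = Σ (Vec ℚ _) λ y → InS F y × lookup y j ≢ lookup y k

OnFlat : ∀ {A : Set} {d} → List (Pair d) → Vec A d → Set
OnFlat S y = All (λ { (j , k) → lookup y j ≡ lookup y k }) S

Member : ∀ {d m} → System d m → List (Pair d) → Vec ℚ d → Set
Member F S y = InPo F y × OnFlat S y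

-- S ⊆ ℋ and P° ∩ ⋂ S ≠ ∅  (S gives an element of 𝓛(P°,ℋ))
IsMember : ∀ {d m} → System d m → List (Pair d) → Set
IsMember F S = All (InH F) S × ∃ (Member F S)

SameSet : ∀ {d m} → System d m → List (Pair d) → List (Pair d) → Set
SameSet F S S′ = ∀ y → Member F S y ⇔ Member F S′ y

Enumerates : ∀ {d m n} → System d m → (Fin n → List (Pair d)) → Set
Enumerates F us =
  (∀ i → IsMember F (us i))
  × (∀ S → IsMember F S → ∃ λ i → SameSet F S (us i))
  × (∀ i j → SameSet F (us i) (us j) → i ≡ j)

-- le v w ≡ true  iff  u_v ≤ u_w in reverse inclusion, i.e. u_w ⊆ u_v
IsOrder : ∀ {d m n} → System d m → (Fin n → List (Pair d))
        → (Fin n → Fin n → Bool) → Set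
IsOrder F us le =
  ∀ v w → (le v w ≡ true) ⇔ (∀ y → Member F (us w) y → Member F (us v) y)

strictBelowSum : ∀ {n} → (Fin n → Fin n → Bool) → (Fin n → ℤ) → Fin n → ℤ
strictBelowSum {n} le μ w =
  Σℤ n (λ v → if le v w ∧ not (does (v Fin.≟ w)) then μ v else + 0)

-- μ v = μ(0̂, u_v) where z is the index of 0̂ = P°
IsMobiusFromBottom : ∀ {n} → (Fin n → Fin n → Bool) → Fin n → (Fin n → ℤ) → Set
IsMobiusFromBottom le z μ =
  μ z ≡ + 1 × (∀ w → w ≢ z → μ w ≡ ℤ.- strictBelowSum le μ w)

-- x ∈ t·(P) ∩ ℤ^d  with x ≥ 0   (f_i(x) = t for all i)
InTP : ∀ {d m} → System d m → ℕ → Vec ℕ d → Set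
InTP F t x = ∀ i → evalF (F i) (vecℕtoℚ x) ≡ ℕtoℚ t

AllPos : ∀ {d} → Vec ℕ d → Set
AllPos x = ∀ j → 0 ℕ.< lookup x j

Distinct : ∀ {A : Set} {d} → Vec A d → Set
Distinct x = ∀ j k → j ≢ k → lookup x j ≢ lookup x k

PtsOpen : ∀ {d m} → System d m → List (Pair d) → ℕ → Vec ℕ d → Set
PtsOpen F S t x = InTP F t x × AllPos x × OnFlat S x

PtsClosed : ∀ {d m} → System d m → List (Pair d) → ℕ → Vec ℕ d → Set
PtsClosed F S t x = InTP F t x × OnFlat S x

MagicPt : ∀ {d m} → System d m → ℕ → Vec ℕ d → Set
MagicPt F t x = InTP F t x × AllPos x × Distinct x

IsPerm : ∀ {d} → Vec (Fin d) d → Set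
IsPerm σ = Distinct σ

Compatible : ∀ {d} → Vec ℕ d → Vec (Fin d) d → Set
Compatible x σ = ∀ a b → toℕ a ℕ.< toℕ b → lookup x (lookup σ a) ℕ.≤ lookup x (lookup σ b)

RealizableIn : ∀ {d m} → System d m → Vec (Fin d) d → Set
RealizableIn F σ = Σ (Vec ℚ _) λ y → InPo F y
  × (∀ a b → toℕ a ℕ.< toℕ b → lookup y (lookup σ a) ℚ.< lookup y (lookup σ b))

CompatPair : ∀ {d m} → System d m → ℕ → Vec ℕ d × Vec (Fin d) d → Set
CompatPair F t (x , σ) = InTP F t x × IsPerm σ × Compatible x σ × RealizableIn F σ

ConstantPositiveWeight : ∀ {d m} → System d m → Set
ConstantPositiveWeight F = ∃ λ w → 0ℚ ℚ.< w × (∀ i → evalF (F i) ones ≡ w)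

EveryVariableAppears : ∀ {d m} → System d m → Set
EveryVariableAppears {d} F = ∀ (j : Fin d) → ∃ λ i → lookup (F i) j ≢ 0ℚ

Consistent : ∀ {d m} → System d m → Set
Consistent F = ∃ (InS F)

MagicLabellingExists : ∀ {d m} → System d m → Set
MagicLabellingExists F = ∃ λ (x : Vec ℕ _) → AllPos x × Distinct x
  × (∀ i i′ → evalF (F i) (vecℕtoℚ x) ≡ evalF (F i′) (vecℕtoℚ x))

{-# OPTIONS --safe #-}

-- Because the forms have constant positive weight, every flat of the arrangement passes through
-- the point of s on the diagonal.  Hence the arrangement in P° may be replaced by the central
-- arrangement of the hyperplanes x_j = x_k in the direction space V = {f₁ = ⋯ = fₘ = 0}, and an
-- integer point x of tP by its difference with a multiple of that point.
--
-- The first formula is Möbius inversion: x lies on exactly the flats below the flat cut out by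
-- the ties x_j = x_k of x, and the Möbius function sums to zero below every flat except 0̂.
--
-- For the second, fix x and let A be the set of its ties.  The permutations compatible with x and
-- realizable in P° correspond to the regions of A in V: sort x perturbed towards the region.
-- Both the number of regions and Whitney's expansion μ(0̂,u) = Σ (-1)^|T|, over the T ⊆ A cutting
-- out u, obey deletion-restriction.  The sign of a term of the latter is (-1)^codim, so that
-- passing to absolute values no cancellation occurs and Σ |μ(0̂,u)|, over the flats u
-- containing x, equals the number of regions (Zaslavsky's theorem).

module Submission where

open import Defs
open import Data.Nat as ℕ using (ℕ; zero; suc; _≤_; s≤s)
open import Data.Nat.Properties as ℕP using ()
open import Data.Integer as ℤ using (ℤ; +_; _*_; ∣_∣)
open import Data.Integer.Properties as ℤP using ()
open import Data.Integer.Tactic.RingSolver using (solve-∀)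
open import Data.Rational as ℚ using (ℚ; 0ℚ; 1ℚ; _+_; -_; _-_; _<_; 1/_) renaming (_*_ to _·_)
open import Data.Rational.Properties as ℚP using ()
open import Data.Rational.Solver using (module +-*-Solver)
open import Data.Rational.Unnormalised as ℚᵘ using (mkℚᵘ)
import Data.Rational.Unnormalised.Properties as ℚᵘP
open import Data.Bool using (Bool; true; false; if_then_else_; _∧_; not)
open import Data.Fin as Fin using (Fin; toℕ)
open import Data.Fin.Properties as FinP using ()
open import Data.Fin.Induction using (spo-wellFounded)
open import Data.Vec using (Vec; []; _∷_; lookup; zipWith; replicate; tabulate)
open import Data.Vec.Properties using (lookup-zipWith; lookup-replicate; lookup∘tabulate; lookup-map; ≡-dec)
open import Data.List as List using (List; []; _∷_; _++_; length; filter; allFin; cartesianProduct)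
open import Data.List.Properties using (length-map; length-++)
open import Data.List.Membership.Propositional using (_∈_)
open import Data.List.Membership.Propositional.Properties using (∈-lookup; ∈-filter⁺; ∈-filter⁻; ∈-map⁺; ∈-map⁻; ∈-++⁺ˡ; ∈-++⁺ʳ; ∈-++⁻; ∈-cartesianProduct⁺; ∈-allFin)
open import Data.List.Relation.Unary.All as All using (All; []; _∷_)
open import Data.List.Relation.Unary.All.Properties as AllP using ()
open import Data.List.Relation.Unary.AllPairs using ([]; _∷_)
open import Data.List.Relation.Unary.Any as Any using (Any; here; there)
open import Data.List.Relation.Unary.Any.Properties using (lookup-index)
open import Data.List.Relation.Unary.Unique.Propositional using (Unique)
import Data.List.Relation.Unary.Unique.Propositional.Properties as UniqueP
open import Data.List.Relation.Binary.Permutation.Propositional as Perm using (_↭_; ↭-sym)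
open import Data.List.Relation.Binary.Permutation.Propositional.Properties using (All-resp-↭; ++-comm)
open import Data.Product using (Σ; ∃; _×_; _,_; proj₁; proj₂)
open import Data.Sum using (_⊎_; inj₁; inj₂; [_,_])
open import Function.Bundles using (_⇔_; mk⇔; Equivalence)
open import Function.Definitions using (Injective)
open import Induction.WellFounded using (Acc; acc)
open import Relation.Nullary using (¬_; Dec; yes; no; does; contradiction)
open import Relation.Nullary.Decidable using (¬?; _×-dec_)
open import Relation.Binary using (tri<; tri≈; tri>; DecidableEquality; IsStrictPartialOrder)
open import Relation.Binary.PropositionalEquality as Eq using (_≡_; _≢_; refl; sym; trans; cong; cong₂; subst; subst₂; module ≡-Reasoning)
open import Algebra.Properties.CommutativeSemigroup ℕP.+-commutativeSemigroup using () renaming (interchange to ℕ-interchange)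
open import Algebra.Properties.CommutativeSemigroup ℤP.+-commutativeSemigroup using () renaming (interchange to ℤ-interchange)
open +-*-Solver using (solve; _:=_; _:+_; _:*_; :-_; _:-_; con)
open Equivalence using (to; from)

-- Rational inequalities and linear forms

-- The counts are numbers, so every alternative in the recursion has to be decided. Each flat
-- therefore carries a finite list of vectors that detects the linear forms vanishing on it; testing
-- `gap p` on the list decides whether `p` cuts the flat or contains it, and deletion-restriction
-- itself then decides which sign vectors occur. Flats are handled as lists of pairs, and many lists
-- cut out the same flat. The sign of the codimension is computed along a list and has to be shown
-- independent of it. The recursions carry the pairs already imposed in `S` and those still to be
-- treated in `A`; the lattice enters only when `A` is exhausted, through the index of the flat of
-- `S`. Taking for `A` only the ties of `x` localises the problem: a pair vanishing on a flat
-- through the shifted `x` is tied at `x`, so Whitney's sum over subsets of `A` still gives the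
-- Möbius function on these flats, and it is zero on all others. A point `x` with zero coordinates
-- lies in no dilate of P°, which does no harm in V, where only differences of coordinates matter.

*-pos : ∀ {a b} → 0ℚ < a → 0ℚ < b → 0ℚ < a · b
*-pos {a} {b} 0<a 0<b = ℚP.positive⁻¹ (a · b) {{ℚP.pos*pos⇒pos a {{ℚ.positive 0<a}} b {{ℚ.positive 0<b}}}}

+-pos : ∀ {a b} → 0ℚ < a → 0ℚ < b → 0ℚ < a + b
+-pos = ℚP.+-mono-<

+-pos-nonNeg : ∀ {a b} → 0ℚ < a → 0ℚ ℚ.≤ b → 0ℚ < a + b
+-pos-nonNeg = ℚP.+-mono-<-≤

*-nonNeg : ∀ {a b} → 0ℚ ℚ.≤ a → 0ℚ ℚ.≤ b → 0ℚ ℚ.≤ a · b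
*-nonNeg {a} {b} 0≤a 0≤b =
  ℚP.nonNegative⁻¹ (a · b) {{ℚP.nonNeg*nonNeg⇒nonNeg a {{ℚ.nonNegative 0≤a}} b {{ℚ.nonNegative 0≤b}}}}

<⇒0<- : ∀ {a b} → a < b → 0ℚ < b - a
<⇒0<- {a} {b} a<b = subst (_< b - a) (ℚP.+-inverseʳ a) (ℚP.+-monoˡ-< (- a) a<b)

0<-⇒< : ∀ {a b} → 0ℚ < b - a → a < b
0<-⇒< {a} {b} p = subst₂ _<_ (ℚP.+-identityˡ a)
  (solve 2 (λ a b → (b :- a) :+ a := b) refl a b) (ℚP.+-monoˡ-< a p)

≤⇒0≤- : ∀ {a b} → a ℚ.≤ b → 0ℚ ℚ.≤ b - a
≤⇒0≤- {a} {b} a≤b = subst (ℚ._≤ b - a) (ℚP.+-inverseʳ a) (ℚP.+-monoˡ-≤ (- a) a≤b)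

-≡0⇒≡ : ∀ {a b} → a - b ≡ 0ℚ → a ≡ b
-≡0⇒≡ {a} {b} e = trans (sym (solve 2 (λ a b → (a :- b) :+ b := a) refl a b))
  (trans (cong (_+ b) e) (ℚP.+-identityˡ b))

≡⇒-≡0 : ∀ {a b} → a ≡ b → a - b ≡ 0ℚ
≡⇒-≡0 {a} refl = ℚP.+-inverseʳ a

inverse : ∀ {a} → a ≢ 0ℚ → ∃ λ r → r · a ≡ 1ℚ
inverse {a} a≢0 = (1/ a) , ℚP.*-inverseˡ a
  where instance _ = ℚ.≢-nonZero a≢0

inverse-pos : ∀ {a} → 0ℚ < a → ∃ λ r → 0ℚ < r × r · a ≡ 1ℚ
inverse-pos {a} 0<a =
  (1/ a) , ℚP.positive⁻¹ (1/ a) {{ℚP.1/pos⇒pos a {{pos}}}} , ℚP.*-inverseˡ a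
  where
  pos = ℚ.positive 0<a
  instance _ = ℚP.pos⇒nonZero a {{pos}}

*-cancel-0 : ∀ {a b} → a ≢ 0ℚ → a · b ≡ 0ℚ → b ≡ 0ℚ
*-cancel-0 {a} {b} a≢0 ab≡0 with inverse a≢0
... | r , ra≡1 = begin
  b            ≡⟨ sym (ℚP.*-identityˡ b) ⟩
  1ℚ · b       ≡⟨ cong (_· b) (sym ra≡1) ⟩
  (r · a) · b  ≡⟨ ℚP.*-assoc r a b ⟩
  r · (a · b)  ≡⟨ cong (r ·_) ab≡0 ⟩
  r · 0ℚ       ≡⟨ ℚP.*-zeroʳ r ⟩
  0ℚ           ∎
  where open ≡-Reasoning

pos⇒≢0 : ∀ {a} → 0ℚ < a → a ≢ 0ℚ
pos⇒≢0 0<a a≡0 = ℚP.<⇒≢ 0<a (sym a≡0)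

sign-cases : ∀ {a} → a ≢ 0ℚ → 0ℚ < a ⊎ 0ℚ < - a
sign-cases {a} a≢0 with ℚP.<-cmp 0ℚ a
... | tri< 0<a _ _ = inj₁ 0<a
... | tri≈ _ 0≡a _ = contradiction (sym 0≡a) a≢0
... | tri> _ _ a<0 = inj₂ (ℚP.neg-antimono-< a<0)

-- With `c = |b|` and `r = 1/a`, the threshold `1 + c·r` times `a` is `a + c`. The left side then
-- splits `K·a + b` into `a > 0`, `c + b ≥ 0` and a nonnegative multiple of `a` once `K` passes the
-- threshold.
large-identity : ∀ a c b K r → r · a ≡ 1ℚ → (a + (c + b)) + (K - (1ℚ + c · r)) · a ≡ K · a + b
large-identity a c b K r ra≡1 = begin
  (a + (c + b)) + (K - (1ℚ + c · r)) · a
    ≡⟨ solve 5 (λ a c b K r → (a :+ (c :+ b)) :+ (K :- (con 1ℚ :+ c :* r)) :* a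
                   := (K :* a :+ b) :+ c :* (con 1ℚ :- r :* a)) refl a c b K r ⟩
  (K · a + b) + c · (1ℚ - r · a)
    ≡⟨ cong (λ z → (K · a + b) + c · (1ℚ - z)) ra≡1 ⟩
  (K · a + b) + c · (1ℚ - 1ℚ)
    ≡⟨ solve 2 (λ x c → x :+ c :* (con 1ℚ :- con 1ℚ) := x) refl (K · a + b) c ⟩
  K · a + b ∎
  where open ≡-Reasoning

eventually-pos : ∀ {a} b → 0ℚ < a → ∃ λ K₀ → 0ℚ < K₀ × (∀ K → K₀ ℚ.≤ K → 0ℚ < K · a + b)
eventually-pos {a} b 0<a with inverse-pos 0<a
... | r , 0<r , ra≡1 = K₀ , K₀-pos , λ K K₀≤K →
    subst (0ℚ <_) (eq K) (+-pos-nonNeg (+-pos-nonNeg 0<a 0≤∣b∣+b)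
      (*-nonNeg (≤⇒0≤- K₀≤K) (ℚP.<⇒≤ 0<a)))
  where
  ∣b∣ = ℚ.∣ b ∣
  K₀ = 1ℚ + ∣b∣ · r
  K₀-pos : 0ℚ < K₀
  K₀-pos = +-pos-nonNeg (ℚP.positive⁻¹ 1ℚ) (*-nonNeg (ℚP.0≤∣p∣ b) (ℚP.<⇒≤ 0<r))
  0≤∣b∣+b : 0ℚ ℚ.≤ ∣b∣ + b
  0≤∣b∣+b with ℚP.≤-total 0ℚ b
  ... | inj₁ 0≤b = ℚP.+-mono-≤ (ℚP.0≤∣p∣ b) 0≤b
  ... | inj₂ b≤0 = ℚP.≤-reflexive (sym (trans (cong (_+ b)
          (trans (sym (ℚP.∣-p∣≡∣p∣ b)) (ℚP.0≤p⇒∣p∣≡p (ℚP.neg-antimono-≤ b≤0))))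
          (ℚP.+-inverseˡ b)))
  eq : ∀ K → (a + (∣b∣ + b)) + (K - K₀) · a ≡ K · a + b
  eq K = large-identity a ∣b∣ b K r ra≡1

-- The implication lets a single `K` serve a whole list in which only some entries have a strict
-- sign to preserve.
eventually-pos-if : ∀ a b → ∃ λ K₀ → 0ℚ < K₀ × (∀ K → K₀ ℚ.≤ K → 0ℚ < a → 0ℚ < K · a + b)
eventually-pos-if a b = helper (0ℚ ℚP.<? a)
  where
  helper : Dec (0ℚ < a) → _
  helper (no ¬p) = 1ℚ , ℚP.positive⁻¹ 1ℚ , λ _ _ p → contradiction p ¬p
  helper (yes p) = let K₀ , 0<K₀ , h = eventually-pos b p in K₀ , 0<K₀ , λ K le _ → h K le

eventually-all-pos : {B : Set} (f g : B → ℚ) (xs : List B) →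
  ∃ λ K₀ → 0ℚ < K₀ × (∀ K → K₀ ℚ.≤ K → All (λ x → 0ℚ < f x → 0ℚ < K · f x + g x) xs)
eventually-all-pos f g [] = 1ℚ , ℚP.positive⁻¹ 1ℚ , λ _ _ → []
eventually-all-pos f g (x ∷ xs) =
  let K₀ , 0<K₀ , h  = eventually-all-pos f g xs
      K₁ , _    , h₁ = eventually-pos-if (f x) (g x)
  in K₀ ℚ.⊔ K₁ , ℚP.<-≤-trans 0<K₀ (ℚP.p≤p⊔q K₀ K₁) , λ K le →
     h₁ K (ℚP.≤-trans (ℚP.p≤q⊔p K₀ K₁) le) ∷ h K (ℚP.≤-trans (ℚP.p≤p⊔q K₀ K₁) le)

lin : ∀ {d} → ℚ → Vec ℚ d → ℚ → Vec ℚ d → Vec ℚ d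
lin a x b y = zipWith (λ u v → a · u + b · v) x y

lookup-lin : ∀ {d} a (x : Vec ℚ d) b y j → lookup (lin a x b y) j ≡ a · lookup x j + b · lookup y j
lookup-lin a x b y j = lookup-zipWith _ j x y

Linear : ∀ {d} → (Vec ℚ d → ℚ) → Set
Linear f = ∀ a x b y → f (lin a x b y) ≡ a · f x + b · f y

evalF-linear : ∀ {d} (φ : Form d) → Linear (evalF φ)
evalF-linear []      a []      b []      =
  solve 2 (λ a b → con 0ℚ := a :* con 0ℚ :+ b :* con 0ℚ) refl a b
evalF-linear (c ∷ φ) a (u ∷ x) b (v ∷ y) =
  trans (cong (λ e → c · (a · u + b · v) + e) (evalF-linear φ a x b y))
    (solve 7 (λ c a u b v p q → c :* (a :* u :+ b :* v) :+ (a :* p :+ b :* q)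
        := a :* (c :* u :+ p) :+ b :* (c :* v :+ q)) refl c a u b v (evalF φ x) (evalF φ y))

-- Opaque so that unification can recover p and v from gap p v.
opaque
  gap : ∀ {d} → Pair d → Vec ℚ d → ℚ
  gap (j , k) y = lookup y k - lookup y j

  gap-linear : ∀ {d} (p : Pair d) → Linear (gap p)
  gap-linear (j , k) a x b y =
    trans (cong₂ _-_ (lookup-lin a x b y k) (lookup-lin a x b y j))
      (solve 6 (λ a b u v w z → (a :* u :+ b :* v) :- (a :* w :+ b :* z)
          := a :* (u :- w) :+ b :* (v :- z)) refl a b (lookup x k) (lookup y k) (lookup x j) (lookup y j))

  gap≡0⇒≡ : ∀ {d} (p : Pair d) v → gap p v ≡ 0ℚ → lookup v (proj₁ p) ≡ lookup v (proj₂ p)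
  gap≡0⇒≡ p v e = sym (-≡0⇒≡ e)

  ≡⇒gap≡0 : ∀ {d} (p : Pair d) v → lookup v (proj₁ p) ≡ lookup v (proj₂ p) → gap p v ≡ 0ℚ
  ≡⇒gap≡0 p v e = ≡⇒-≡0 (sym e)

  gap-swap : ∀ {d} j k (v : Vec ℚ d) → gap (k , j) v ≡ - gap (j , k) v
  gap-swap j k v = solve 2 (λ a b → a :- b := :- (b :- a)) refl (lookup v j) (lookup v k)

  <⇒gap-pos : ∀ {d} {j k} (v : Vec ℚ d) → lookup v j < lookup v k → 0ℚ < gap (j , k) v
  <⇒gap-pos v = <⇒0<-

  gap-pos⇒< : ∀ {d} {j k} (v : Vec ℚ d) → 0ℚ < gap (j , k) v → lookup v j < lookup v k
  gap-pos⇒< v = 0<-⇒<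

-- A finite set of vectors detecting the linear forms that vanish on the subspace U.
Spanned : ∀ {d} → (Vec ℚ d → Set) → Set
Spanned {d} U = Σ (List (Vec ℚ d)) λ G → All U G
  × (∀ ℓ → Linear ℓ → All (λ g → ℓ g ≡ 0ℚ) G → ∀ v → U v → ℓ v ≡ 0ℚ)

zeros : ∀ {d} → Vec ℚ d
zeros = replicate _ 0ℚ

linear-zeros : ∀ {d} {f : Vec ℚ d → ℚ} → Linear f → f zeros ≡ 0ℚ
linear-zeros {f = f} lf = trans (trans (cong f (lin00 _)) (lf 0ℚ zeros 0ℚ zeros))
  (solve 1 (λ x → con 0ℚ :* x :+ con 0ℚ :* x := con 0ℚ) refl (f zeros))
  where
  lin00 : ∀ d → zeros {d} ≡ lin 0ℚ zeros 0ℚ zeros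
  lin00 zero    = refl
  lin00 (suc d) = cong (0ℚ ∷_) (lin00 d)

prepend0-linear : ∀ {d} {f : Vec ℚ (suc d) → ℚ} → Linear f → Linear (λ v → f (0ℚ ∷ v))
prepend0-linear {f = f} lf a x b y = trans
  (cong (λ h → f (h ∷ lin a x b y)) (solve 2 (λ a b → con 0ℚ := a :* con 0ℚ :+ b :* con 0ℚ) refl a b))
  (lf a (0ℚ ∷ x) b (0ℚ ∷ y))

full-spanned : ∀ d → Σ (List (Vec ℚ d)) λ G →
  ∀ ℓ → Linear ℓ → All (λ g → ℓ g ≡ 0ℚ) G → ∀ v → ℓ v ≡ 0ℚ
full-spanned zero = [] , λ { ℓ lin-ℓ _ [] → linear-zeros lin-ℓ }
full-spanned (suc d) with full-spanned d
... | G , h = (1ℚ ∷ zeros) ∷ List.map (0ℚ ∷_) G , λ { ℓ lin-ℓ (e ∷ es) (c ∷ v) → begin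
  ℓ (c ∷ v)                                      ≡⟨ cong ℓ (cong₂ _∷_ (head-eq c) (tail-eq c v)) ⟩
  ℓ (lin c (1ℚ ∷ zeros) 1ℚ (0ℚ ∷ v))             ≡⟨ lin-ℓ c _ 1ℚ _ ⟩
  c · ℓ (1ℚ ∷ zeros) + 1ℚ · ℓ (0ℚ ∷ v)           ≡⟨ cong₂ (λ p q → c · p + 1ℚ · q) e
                                                      (h _ (prepend0-linear lin-ℓ) (AllP.map⁻ es) v) ⟩
  c · 0ℚ + 1ℚ · 0ℚ                               ≡⟨ solve 1 (λ c → c :* con 0ℚ :+ con 1ℚ :* con 0ℚ := con 0ℚ) refl c ⟩
  0ℚ                                             ∎ }
  where
  open ≡-Reasoning
  head-eq : ∀ c → c ≡ c · 1ℚ + 1ℚ · 0ℚ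
  head-eq = solve 1 (λ c → c := c :* con 1ℚ :+ con 1ℚ :* con 0ℚ) refl
  tail-eq : ∀ {n} c (v : Vec ℚ n) → v ≡ lin c zeros 1ℚ v
  tail-eq c []      = refl
  tail-eq c (x ∷ v) = cong₂ _∷_ (solve 2 (λ c x → x := c :* con 0ℚ :+ con 1ℚ :* x) refl c x) (tail-eq c v)

find-nonzero : ∀ {d} (f : Vec ℚ d → ℚ) G →
  (Any (λ g → f g ≢ 0ℚ) G) ⊎ All (λ g → f g ≡ 0ℚ) G
find-nonzero f [] = inj₂ []
find-nonzero f (g ∷ G) with f g ℚP.≟ 0ℚ | find-nonzero f G
... | no  ne | _      = inj₁ (here ne)
... | yes _  | inj₁ a = inj₁ (there a)
... | yes e  | inj₂ a = inj₂ (e ∷ a)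

Closed : ∀ {d} → (Vec ℚ d → Set) → Set
Closed U = ∀ a x b y → U x → U y → U (lin a x b y)

-- Eliminate with a vector g₀ on which f does not vanish.
spanned-∩-ker : ∀ {d} {U : Vec ℚ d → Set} {f : Vec ℚ d → ℚ} → Closed U → Linear f →
  Spanned U → Spanned (λ v → U v × f v ≡ 0ℚ)
spanned-∩-ker {d} {U} {f} closed lf (G , inU , h) with find-nonzero f G
... | inj₂ f≡0 = G , All.zip (inU , f≡0) , λ ℓ lℓ a v (u , _) → h ℓ lℓ a v u
... | inj₁ nz with All.lookupAny inU nz
... | g₀∈U , fg₀≢0 = List.map elim G , AllP.map⁺ (All.map elim-in inU) , detect
  where
  g₀ = Any.lookup nz
  elim : Vec ℚ d → Vec ℚ d
  elim g = lin (f g₀) g (- f g) g₀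
  elim-in : ∀ {g} → U g → U (elim g) × f (elim g) ≡ 0ℚ
  elim-in {g} u = closed (f g₀) g (- f g) g₀ u g₀∈U ,
    trans (lf (f g₀) g (- f g) g₀) (solve 2 (λ p q → p :* q :+ (:- q) :* p := con 0ℚ) refl (f g₀) (f g))
  detect : ∀ ℓ → Linear ℓ → All (λ g → ℓ g ≡ 0ℚ) (List.map elim G) → ∀ v → U v × f v ≡ 0ℚ → ℓ v ≡ 0ℚ
  detect ℓ lℓ zs v (v∈U , fv≡0) = *-cancel-0 fg₀≢0 (begin
    f g₀ · ℓ v            ≡⟨ solve 3 (λ a b c → a :* b := (a :* b :- c :* con 0ℚ)) refl (f g₀) (ℓ v) (ℓ g₀) ⟩
    f g₀ · ℓ v - ℓ g₀ · 0ℚ  ≡⟨ cong (λ z → f g₀ · ℓ v - ℓ g₀ · z) (sym fv≡0) ⟩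
    ℓ′ v                  ≡⟨ h ℓ′ ℓ′-linear (All.map (λ {g} e → trans (ℓ′-elim g) e) (AllP.map⁻ zs)) v v∈U ⟩
    0ℚ                    ∎)
    where
    open ≡-Reasoning
    -- On the old generators `ℓ′` agrees with `ℓ` after elimination, so it vanishes on all of `U`;
    -- on the kernel of `f` it is `f g₀` times `ℓ`.
    ℓ′ : Vec ℚ d → ℚ
    ℓ′ v = f g₀ · ℓ v - ℓ g₀ · f v
    ℓ′-linear : Linear ℓ′
    ℓ′-linear a x b y = trans (cong₂ (λ p q → f g₀ · p - ℓ g₀ · q) (lℓ a x b y) (lf a x b y))
      (solve 8 (λ s t a b p q u w → s :* (a :* p :+ b :* q) :- t :* (a :* u :+ b :* w)
         := a :* (s :* p :- t :* u) :+ b :* (s :* q :- t :* w)) refl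
         (f g₀) (ℓ g₀) a b (ℓ x) (ℓ y) (f x) (f y))
    ℓ′-elim : ∀ g → ℓ′ g ≡ ℓ (elim g)
    ℓ′-elim g = trans (solve 4 (λ s t p u → s :* p :- t :* u := s :* p :+ (:- u) :* t) refl (f g₀) (ℓ g₀) (ℓ g) (f g))
      (sym (lℓ (f g₀) g (- f g) g₀))

-- Flats and the sign of their codimension

onFlat-lin : ∀ {d} (S : List (Pair d)) a x b y → OnFlat S x → OnFlat S y → OnFlat S (lin a x b y)
onFlat-lin []            a x b y []         []         = []
onFlat-lin ((j , k) ∷ S) a x b y (e₁ ∷ es₁) (e₂ ∷ es₂) =
  trans (lookup-lin a x b y j) (trans (cong₂ (λ p q → a · p + b · q) e₁ e₂) (sym (lookup-lin a x b y k)))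
  ∷ onFlat-lin S a x b y es₁ es₂

spanned-resp : ∀ {d} {U U′ : Vec ℚ d → Set} → (∀ {v} → U v → U′ v) → (∀ {v} → U′ v → U v) →
  Spanned U → Spanned U′
spanned-resp to from (G , inU , h) = G , All.map to inU , λ ℓ lℓ zs v u → h ℓ lℓ zs v (from u)

kernel-closed : ∀ {d} {f : Vec ℚ d → ℚ} → Linear f → Closed (λ v → f v ≡ 0ℚ)
kernel-closed lf a x b y ex ey = trans (lf a x b y) (trans (cong₂ (λ p q → a · p + b · q) ex ey)
  (solve 2 (λ a b → a :* con 0ℚ :+ b :* con 0ℚ := con 0ℚ) refl a b))

-- The direction space of s.
Dir : ∀ {d m} → System d m → Vec ℚ d → Set
Dir F v = ∀ i → evalF (F i) v ≡ 0ℚ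

dir-closed : ∀ {d m} (F : System d m) → Closed (Dir F)
dir-closed F a x b y x∈ y∈ i = kernel-closed (evalF-linear (F i)) a x b y (x∈ i) (y∈ i)

dir-spanned : ∀ {d m} (F : System d m) → Spanned (Dir F)
dir-spanned {d} {zero}  F =
  let G , h = full-spanned d in G , All.universal (λ _ ()) G , λ ℓ lℓ zs v _ → h ℓ lℓ zs v
dir-spanned {d} {suc m} F =
  spanned-resp (λ { (h , h₀) Fin.zero → h₀ ; (h , h₀) (Fin.suc i) → h i })
               (λ h → (λ i → h (Fin.suc i)) , h Fin.zero)
    (spanned-∩-ker {U = Dir F′} (dir-closed F′) (evalF-linear (F Fin.zero)) (dir-spanned F′))
  where
  F′ : System d m
  F′ i = F (Fin.suc i)

module Flats {d m : ℕ} (F : System d m) where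

  InFlat : List (Pair d) → Vec ℚ d → Set
  InFlat S v = Dir F v × OnFlat S v

  -- Inclusion of flats inside the direction space, not of lists: the equations of `S′` may follow
  -- from those of `S` only with the help of the forms.
  Sub : List (Pair d) → List (Pair d) → Set
  Sub S S′ = ∀ v → InFlat S v → OnFlat S′ v

  inFlat-closed : ∀ S → Closed (InFlat S)
  inFlat-closed S a x b y (x∈ , xS) (y∈ , yS) =
    dir-closed F a x b y x∈ y∈ , onFlat-lin S a x b y xS yS

  inFlat-spanned : ∀ S → Spanned (InFlat S)
  inFlat-spanned []      = spanned-resp (λ h → h , []) proj₁ (dir-spanned F)
  inFlat-spanned (p ∷ S) =
    spanned-resp (λ {v} ((v∈ , vS) , e) → v∈ , gap≡0⇒≡ p v e ∷ vS)
                 (λ { {v} (v∈ , e ∷ vS) → (v∈ , vS) , ≡⇒gap≡0 p v e })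
      (spanned-∩-ker {U = InFlat S} (inFlat-closed S) (gap-linear p) (inFlat-spanned S))

  inFlat-tail : ∀ {p S v} → InFlat (p ∷ S) v → InFlat S v
  inFlat-tail (v∈ , _ ∷ vS) = v∈ , vS

  inFlat-gap : ∀ {p S v} → InFlat (p ∷ S) v → gap p v ≡ 0ℚ
  inFlat-gap {p} {v = v} (_ , e ∷ _) = ≡⇒gap≡0 p v e

  inFlat-cons : ∀ {p S v} → InFlat S v → gap p v ≡ 0ℚ → InFlat (p ∷ S) v
  inFlat-cons {p} {v = v} (v∈ , vS) e = v∈ , gap≡0⇒≡ p v e ∷ vS

  inFlat-zeros : ∀ S → InFlat S zeros
  inFlat-zeros S = (λ i → linear-zeros (evalF-linear (F i))) ,
    All.universal (λ { (j , k) → trans (lookup-replicate j 0ℚ) (sym (lookup-replicate k 0ℚ)) }) S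

  Vanishes : List (Pair d) → Pair d → Set
  Vanishes S p = ∀ v → InFlat S v → gap p v ≡ 0ℚ

  Cuts : List (Pair d) → Pair d → Set
  Cuts S p = ∃ λ v → InFlat S v × gap p v ≢ 0ℚ

  -- The form `gap p` vanishes on the flat as soon as it vanishes on the finite spanning list;
  -- otherwise a member of that list is the witness.
  cuts? : ∀ S p → Cuts S p ⊎ Vanishes S p
  cuts? S p = helper (inFlat-spanned S)
    where
    helper : Spanned (InFlat S) → Cuts S p ⊎ Vanishes S p
    helper (G , inS , h) = helper′ (find-nonzero (gap p) G)
      where
      helper′ : (Any (λ g → gap p g ≢ 0ℚ) G) ⊎ All (λ g → gap p g ≡ 0ℚ) G → Cuts S p ⊎ Vanishes S p
      helper′ (inj₁ nz) = inj₁ (Any.lookup nz , All.lookupAny inS nz)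
      helper′ (inj₂ zs) = inj₂ (h (gap p) (gap-linear p) zs)

  eliminate : ∀ S (p : Pair d) {v w} → InFlat S v → InFlat S w →
    InFlat (p ∷ S) (lin (gap p v) w (- gap p w) v)
  eliminate S p {v} {w} v∈ w∈ = inFlat-cons {p} {S} (inFlat-closed S (gap p v) w (- gap p w) v w∈ v∈)
    (trans (gap-linear p (gap p v) w (- gap p w) v)
      (solve 2 (λ a b → a :* b :+ (:- b) :* a := con 0ℚ) refl (gap p v) (gap p w)))

  -- Apply `gap q` to the combination of `v` and `w` on which `gap p` vanishes. This is the
  -- proportionality of the two forms on the flat `S`, cross-multiplied to avoid division.
  vanishing-ratio : ∀ S p q {v w} → Vanishes (p ∷ S) q → InFlat S v → InFlat S w →
    gap p v · gap q w ≡ gap p w · gap q v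
  vanishing-ratio S p q {v} {w} van v∈ w∈ = -≡0⇒≡ (begin
    gap p v · gap q w - gap p w · gap q v
      ≡⟨ solve 4 (λ a b c d → a :* b :- c :* d := a :* b :+ (:- c) :* d) refl (gap p v) (gap q w) (gap p w) (gap q v) ⟩
    gap p v · gap q w + - gap p w · gap q v
      ≡⟨ sym (gap-linear q (gap p v) w (- gap p w) v) ⟩
    gap q (lin (gap p v) w (- gap p w) v)
      ≡⟨ van _ (eliminate S p v∈ w∈) ⟩
    0ℚ ∎)
    where open ≡-Reasoning

  -- Two hyperplanes of a space, one containing the other, coincide.
  exchange : ∀ S p q → Cuts S p → Cuts S q → Vanishes (p ∷ S) q → Vanishes (q ∷ S) p
  exchange S p q (v , v∈ , pv≢0) (w , w∈ , qw≢0) van u u∈ =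
    *-cancel-0 qv≢0 (trans (ℚP.*-comm (gap q v) (gap p u))
      (trans (sym (vanishing-ratio S p q van v∈ (inFlat-tail {q} u∈)))
        (trans (cong (gap p v ·_) (inFlat-gap {q} u∈)) (ℚP.*-zeroʳ (gap p v)))))
    where
    qv≢0 : gap q v ≢ 0ℚ
    qv≢0 e = qw≢0 (*-cancel-0 pv≢0 (trans (vanishing-ratio S p q van v∈ w∈)
      (trans (cong (gap p w ·_) e) (ℚP.*-zeroʳ (gap p w)))))

  cuts⇒¬vanishes : ∀ {S p} → Cuts S p → ¬ Vanishes S p
  cuts⇒¬vanishes (v , v∈ , ne) van = ne (van v v∈)

  stepSign : ∀ {S p} → Cuts S p ⊎ Vanishes S p → ℤ
  stepSign (inj₁ _) = ℤ.- (+ 1)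
  stepSign (inj₂ _) = + 1

  -- (-1) to the codimension of the flat S in the direction space
  sgn : List (Pair d) → ℤ
  sgn []      = + 1
  sgn (p ∷ S) = stepSign (cuts? S p) ℤ.* sgn S

  sgn-cuts : ∀ {S p} → Cuts S p → sgn (p ∷ S) ≡ ℤ.- sgn S
  sgn-cuts {S} {p} c with cuts? S p
  ... | inj₁ _   = ℤP.-1*i≡-i (sgn S)
  ... | inj₂ van = contradiction van (cuts⇒¬vanishes c)

  sgn-vanishes : ∀ {S p} → Vanishes S p → sgn (p ∷ S) ≡ sgn S
  sgn-vanishes {S} {p} van with cuts? S p
  ... | inj₁ c = contradiction van (cuts⇒¬vanishes c)
  ... | inj₂ _ = ℤP.*-identityˡ (sgn S)

  inFlat-sub : ∀ {S S′} → Sub S S′ → ∀ {v} → InFlat S v → InFlat S′ v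
  inFlat-sub s {v} v∈ = proj₁ v∈ , s v v∈

  vanishes-sub : ∀ {S S′ p} → Sub S S′ → Vanishes S′ p → Vanishes S p
  vanishes-sub s van v v∈ = van v (inFlat-sub s v∈)

  cuts-sub : ∀ {S S′ p} → Sub S S′ → Cuts S p → Cuts S′ p
  cuts-sub s (v , v∈ , ne) = v , inFlat-sub s v∈ , ne

  sub-tail : ∀ {p S} → Sub (p ∷ S) S
  sub-tail v v∈ = proj₂ (inFlat-tail v∈)

  sub-cons : ∀ {p S S′} → Sub S S′ → Sub (p ∷ S) (p ∷ S′)
  sub-cons s v v∈@(_ , e ∷ _) = e ∷ s v (inFlat-tail v∈)

  sub-vanishes : ∀ {p S} → Vanishes S p → Sub S (p ∷ S)
  sub-vanishes {p} van v v∈ = gap≡0⇒≡ p v (van v v∈) ∷ proj₂ v∈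

  ↭⇒sub : ∀ {S S′} → S ↭ S′ → Sub S S′
  ↭⇒sub π v (_ , vS) = All-resp-↭ π vS

  sgn-cons : ∀ {S S′} p → Sub S S′ → Sub S′ S → sgn S ≡ sgn S′ → sgn (p ∷ S) ≡ sgn (p ∷ S′)
  sgn-cons {S} {S′} p s s′ e = helper (cuts? S p)
    where
    helper : Cuts S p ⊎ Vanishes S p → sgn (p ∷ S) ≡ sgn (p ∷ S′)
    helper (inj₁ c) = trans (sgn-cuts c) (trans (cong ℤ.-_ e) (sym (sgn-cuts (cuts-sub s c))))
    helper (inj₂ v) = trans (sgn-vanishes v) (trans e (sym (sgn-vanishes (vanishes-sub s′ v))))

  -- A pair that vanishes on `S` changes the sign in neither order. If both pairs cut `S`, then by
  -- `exchange` either each cuts the flat of the other or neither does.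
  sgn-swap : ∀ S p q → sgn (p ∷ q ∷ S) ≡ sgn (q ∷ p ∷ S)
  sgn-swap S p q = helper (cuts? S p) (cuts? S q)
    where
    step : ∀ p q → Vanishes S p → sgn (p ∷ q ∷ S) ≡ sgn (q ∷ p ∷ S)
    step p q van = trans (sgn-vanishes (vanishes-sub (sub-tail {q}) van))
      (sgn-cons q (sub-vanishes van) (sub-tail {p}) (sym (sgn-vanishes van)))
    helper : Cuts S p ⊎ Vanishes S p → Cuts S q ⊎ Vanishes S q → sgn (p ∷ q ∷ S) ≡ sgn (q ∷ p ∷ S)
    helper (inj₂ van) _          = step p q van
    helper (inj₁ _)   (inj₂ van) = sym (step q p van)
    helper (inj₁ cp)  (inj₁ cq)  = helper′ (cuts? (q ∷ S) p) (cuts? (p ∷ S) q)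
      where
      helper′ : Cuts (q ∷ S) p ⊎ Vanishes (q ∷ S) p → Cuts (p ∷ S) q ⊎ Vanishes (p ∷ S) q →
        sgn (p ∷ q ∷ S) ≡ sgn (q ∷ p ∷ S)
      helper′ (inj₁ c) (inj₁ c′) = trans (sgn-cuts c) (trans
        (cong ℤ.-_ (trans (sgn-cuts cq) (sym (sgn-cuts cp)))) (sym (sgn-cuts c′)))
      helper′ (inj₂ v) (inj₂ v′) = trans (sgn-vanishes v) (trans
        (trans (sgn-cuts cq) (sym (sgn-cuts cp))) (sym (sgn-vanishes v′)))
      helper′ (inj₁ c) (inj₂ v′) = contradiction (exchange S p q cp cq v′) (cuts⇒¬vanishes c)
      helper′ (inj₂ v) (inj₁ c′) = contradiction (exchange S q p cq cp v) (cuts⇒¬vanishes c′)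

  sgn-↭ : ∀ {S S′} → S ↭ S′ → sgn S ≡ sgn S′
  sgn-↭ Perm.refl          = refl
  sgn-↭ (Perm.prep p π)    = sgn-cons p (↭⇒sub π) (↭⇒sub (↭-sym π)) (sgn-↭ π)
  sgn-↭ (Perm.swap {xs = T} p q π) = trans (sgn-swap T p q)
    (sgn-cons q (sub-cons {p} (↭⇒sub π)) (sub-cons {p} (↭⇒sub (↭-sym π)))
      (sgn-cons p (↭⇒sub π) (↭⇒sub (↭-sym π)) (sgn-↭ π)))
  sgn-↭ (Perm.trans π π′)  = trans (sgn-↭ π) (sgn-↭ π′)

  sub-++ʳ : ∀ T {S} → Sub (T ++ S) S
  sub-++ʳ T v (_ , vS) = AllP.++⁻ʳ T vS

  sgn-++ : ∀ T {S} → Sub S T → sgn (T ++ S) ≡ sgn S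
  sgn-++ []      s = refl
  sgn-++ (p ∷ T) {S} s = trans
    (sgn-vanishes (λ v v∈ → ≡⇒gap≡0 p v (All.head (s v (inFlat-sub (sub-++ʳ T) v∈)))))
    (sgn-++ T (λ v v∈ → All.tail (s v v∈)))

  -- Both sides equal the sign of the concatenation, in which the second list vanishes on the first.
  sgn-cong : ∀ {S S′} → Sub S S′ → Sub S′ S → sgn S ≡ sgn S′
  sgn-cong {S} {S′} s s′ = trans (sym (sgn-++ S′ s)) (trans (sgn-↭ (++-comm S′ S)) (sgn-++ S s′))

  sgn² : ∀ S → sgn S ℤ.* sgn S ≡ + 1
  sgn² []      = refl
  sgn² (p ∷ S) = helper (cuts? S p)
    where
    helper : Cuts S p ⊎ Vanishes S p → sgn (p ∷ S) ℤ.* sgn (p ∷ S) ≡ + 1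
    helper (inj₁ c) = trans (cong₂ ℤ._*_ (sgn-cuts c) (sgn-cuts c)) (trans
      (sym (ℤP.neg-distribˡ-* (sgn S) (ℤ.- sgn S))) (trans
      (cong ℤ.-_ (sym (ℤP.neg-distribʳ-* (sgn S) (sgn S)))) (trans (ℤP.neg-involutive _) (sgn² S))))
    helper (inj₂ v) = trans (cong₂ ℤ._*_ (sgn-vanishes v) (sgn-vanishes v)) (sgn² S)

-- Regions

orient : ∀ {d} → Bool → Pair d → Pair d
orient true  p       = p
orient false (j , k) = k , j

gap-flip : ∀ {d} (p : Pair d) v → gap (orient false p) v ≡ - gap p v
gap-flip (j , k) v = gap-swap j k v

orientAll : ∀ {d} (A : List (Pair d)) → Vec Bool (length A) → List (Pair d)
orientAll []      []      = []
orientAll (p ∷ A) (s ∷ τ) = orient s p ∷ orientAll A τ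

Sat : ∀ {d} → List (Pair d) → Vec ℚ d → Set
Sat L v = All (λ p → 0ℚ < gap p v) L

sat-combine : ∀ {d} (L : List (Pair d)) a x b y → 0ℚ < a → 0ℚ < b → Sat L x → Sat L y → Sat L (lin a x b y)
sat-combine []      a x b y _   _   []        []        = []
sat-combine (p ∷ L) a x b y 0<a 0<b (px ∷ sx) (py ∷ sy) =
  subst (0ℚ <_) (sym (gap-linear p a x b y)) (+-pos (*-pos 0<a px) (*-pos 0<b py))
  ∷ sat-combine L a x b y 0<a 0<b sx sy

-- A large multiple of `x` stands in for a small multiple of `y`: up to scale, `x` is moved slightly
-- towards `y`. Strict signs at `x` survive, and a pair with gap zero at `x` takes the gap of `y`.
perturb : ∀ {d} (L : List (Pair d)) x y →
  ∃ λ K → 0ℚ < K × All (λ p → 0ℚ < gap p x → 0ℚ < gap p (lin K x 1ℚ y)) L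
perturb L x y =
  let K , 0<K , h = eventually-all-pos (λ p → gap p x) (λ p → gap p y) L
  in K , 0<K , All.map (λ {p} f pos → subst (0ℚ <_) (eq K p) (f pos)) (h K ℚP.≤-refl)
  where
  eq : ∀ K p → K · gap p x + gap p y ≡ gap p (lin K x 1ℚ y)
  eq K p = trans (cong (λ z → K · gap p x + z) (sym (ℚP.*-identityˡ (gap p y)))) (sym (gap-linear p K x 1ℚ y))

All-apply : ∀ {A : Set} {P Q : A → Set} {xs} → All (λ x → P x → Q x) xs → All P xs → All Q xs
All-apply []       []       = []
All-apply (f ∷ fs) (p ∷ ps) = f p ∷ All-apply fs ps

ind : {P : Set} → Dec P → ℕ
ind (yes _) = 1
ind (no _)  = 0

ind-yes : {P : Set} (D : Dec P) → P → ind D ≡ 1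
ind-yes (yes _) _ = refl
ind-yes (no ¬p) p = contradiction p ¬p

ind-no : {P : Set} (D : Dec P) → ¬ P → ind D ≡ 0
ind-no (yes p) ¬p = contradiction p ¬p
ind-no (no _)  _  = refl

-- Meant for the two sides `P` and `Q` of a region `U` met by a hyperplane: `U` is their union, and
-- the trace `I` on the hyperplane plays the role of their intersection.
ind-inclusion-exclusion : {P Q U I : Set} (P? : Dec P) (Q? : Dec Q) (U? : Dec U) (I? : Dec I) →
  (P → U) → (Q → U) → (U → P ⊎ Q) → (I → P) → (I → Q) → (P → Q → I) →
  ind P? ℕ.+ ind Q? ≡ ind U? ℕ.+ ind I?
ind-inclusion-exclusion (yes p) (yes q) U? I? pu qu upq ip iq pqi
  rewrite ind-yes U? (pu p) | ind-yes I? (pqi p q) = refl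
ind-inclusion-exclusion (yes p) (no ¬q) U? I? pu qu upq ip iq pqi
  rewrite ind-yes U? (pu p) | ind-no I? (λ i → ¬q (iq i)) = refl
ind-inclusion-exclusion (no ¬p) (yes q) U? I? pu qu upq ip iq pqi
  rewrite ind-yes U? (qu q) | ind-no I? (λ i → ¬p (ip i)) = refl
ind-inclusion-exclusion (no ¬p) (no ¬q) U? I? pu qu upq ip iq pqi
  rewrite ind-no U? (λ u → [ ¬p , ¬q ] (upq u)) | ind-no I? (λ i → ¬p (ip i)) = refl

Σ𝔹 : ∀ k → (Vec Bool k → ℕ) → ℕ
Σ𝔹 zero    f = f []
Σ𝔹 (suc k) f = Σ𝔹 k (λ τ → f (true ∷ τ)) ℕ.+ Σ𝔹 k (λ τ → f (false ∷ τ))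

Σ𝔹-cong : ∀ k {f g : Vec Bool k → ℕ} → (∀ τ → f τ ≡ g τ) → Σ𝔹 k f ≡ Σ𝔹 k g
Σ𝔹-cong zero    h = h []
Σ𝔹-cong (suc k) h = cong₂ ℕ._+_ (Σ𝔹-cong k (λ τ → h (true ∷ τ))) (Σ𝔹-cong k (λ τ → h (false ∷ τ)))

Σ𝔹-+ : ∀ k (f g : Vec Bool k → ℕ) → Σ𝔹 k f ℕ.+ Σ𝔹 k g ≡ Σ𝔹 k (λ τ → f τ ℕ.+ g τ)
Σ𝔹-+ zero    f g = refl
Σ𝔹-+ (suc k) f g = trans (ℕ-interchange (Σ𝔹 k (λ τ → f (true ∷ τ))) _ _ _) (cong₂ ℕ._+_ (Σ𝔹-+ k _ _) (Σ𝔹-+ k _ _))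

Σ𝔹-0 : ∀ k {f : Vec Bool k → ℕ} → (∀ τ → f τ ≡ 0) → Σ𝔹 k f ≡ 0
Σ𝔹-0 zero    h = h []
Σ𝔹-0 (suc k) h = cong₂ ℕ._+_ (Σ𝔹-0 k (λ τ → h (true ∷ τ))) (Σ𝔹-0 k (λ τ → h (false ∷ τ)))

module Regions {d m : ℕ} (F : System d m) where
  open Flats F

  -- The sign vectors realised on the flat `S` name the regions into which `A` divides it.
  Realized : List (Pair d) → (A : List (Pair d)) → Vec Bool (length A) → Set
  Realized S A τ = ∃ λ v → InFlat S v × Sat (orientAll A τ) v

  realized-tail : ∀ {S p A s τ} → Realized S (p ∷ A) (s ∷ τ) → Realized S A τ
  realized-tail (v , v∈ , _ ∷ sat) = v , v∈ , sat

  vanishes-orient : ∀ {S p} s → Vanishes S p → Vanishes S (orient s p)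
  vanishes-orient     true  van v v∈ = van v v∈
  vanishes-orient {p = p} false van v v∈ = trans (gap-flip p v) (cong -_ (van v v∈))

  ¬realized-vanishes : ∀ {S p A s τ} → Vanishes S p → ¬ Realized S (p ∷ A) (s ∷ τ)
  ¬realized-vanishes {s = s} van (v , v∈ , pos ∷ _) = pos⇒≢0 pos (vanishes-orient s van v v∈)

  cuts-orient : ∀ {S p} s → Cuts S p → ∃ λ v → InFlat S v × 0ℚ < gap (orient s p) v
  cuts-orient {S} {p} s (v , v∈ , ne) = helper s (sign-cases ne)
    where
    v⁻ = lin (- 1ℚ) v 0ℚ v
    v⁻∈ : InFlat S v⁻
    v⁻∈ = inFlat-closed S (- 1ℚ) v 0ℚ v v∈ v∈
    gap-v⁻ : ∀ q → gap q v⁻ ≡ - gap q v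
    gap-v⁻ q = trans (gap-linear q (- 1ℚ) v 0ℚ v)
      (solve 1 (λ a → (:- con 1ℚ) :* a :+ con 0ℚ :* a := :- a) refl (gap q v))
    helper : ∀ s → 0ℚ < gap p v ⊎ 0ℚ < - gap p v → ∃ λ v → InFlat S v × 0ℚ < gap (orient s p) v
    helper true  (inj₁ pos) = v , v∈ , pos
    helper true  (inj₂ neg) = v⁻ , v⁻∈ , subst (0ℚ <_) (sym (gap-v⁻ p)) neg
    helper false (inj₂ neg) = v , v∈ , subst (0ℚ <_) (sym (gap-flip p v)) neg
    helper false (inj₁ pos) = v⁻ , v⁻∈ , subst (0ℚ <_) (sym eq) pos
      where
      eq : gap (orient false p) v⁻ ≡ gap p v
      eq = trans (gap-flip p v⁻) (trans (cong -_ (gap-v⁻ p))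
        (solve 1 (λ a → :- (:- a) := a) refl (gap p v)))

  -- A point of the region on the hyperplane of `p` is pushed off it by a vector chosen on the side
  -- `s`; the signs for `A` are strict and survive.
  realized-both : ∀ {S p A τ} → Cuts S p → Realized (p ∷ S) A τ → ∀ s → Realized S (p ∷ A) (s ∷ τ)
  realized-both {S} {p} {A} {τ} c (y , y∈ , sat) s =
    let u , u∈ , pos     = cuts-orient s c
        K , 0<K , persist = perturb (orientAll A τ) y u
        gap-eq : gap (orient s p) u ≡ gap (orient s p) (lin K y 1ℚ u)
        gap-eq = sym (trans (gap-linear (orient s p) K y 1ℚ u)
          (trans (cong (λ z → K · z + 1ℚ · gap (orient s p) u) (vanishes-orient {p ∷ S} {p} s (λ v → inFlat-gap {p}) y y∈))
            (solve 2 (λ K a → K :* con 0ℚ :+ con 1ℚ :* a := a) refl K (gap (orient s p) u))))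
    in lin K y 1ℚ u , inFlat-closed S K y 1ℚ u (inFlat-tail {p} y∈) u∈ ,
       subst (0ℚ <_) gap-eq pos ∷ All-apply persist sat

  realized-some : ∀ {S p A τ} → Cuts S p → Realized S A τ →
    Realized S (p ∷ A) (true ∷ τ) ⊎ Realized S (p ∷ A) (false ∷ τ)
  realized-some {S} {p} {A} {τ} c (y , y∈ , sat) = helper (gap p y ℚP.≟ 0ℚ)
    where
    helper : Dec (gap p y ≡ 0ℚ) → Realized S (p ∷ A) (true ∷ τ) ⊎ Realized S (p ∷ A) (false ∷ τ)
    helper (yes e) = inj₁ (realized-both c (y , inFlat-cons {p} y∈ e , sat) true)
    helper (no ne) = helper′ (sign-cases ne)
      where
      helper′ : 0ℚ < gap p y ⊎ 0ℚ < - gap p y → _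
      helper′ (inj₁ pos) = inj₁ (y , y∈ , pos ∷ sat)
      helper′ (inj₂ neg) = inj₂ (y , y∈ , subst (0ℚ <_) (sym (gap-flip p y)) neg ∷ sat)

  -- A segment joining points on the two sides of a hyperplane meets it.
  realized-meet : ∀ {S p A τ} → Realized S (p ∷ A) (true ∷ τ) → Realized S (p ∷ A) (false ∷ τ) →
    Realized (p ∷ S) A τ
  realized-meet {S} {p} {A} {τ} (x , x∈ , px ∷ sx) (y , y∈ , py ∷ sy) =
    lin (gap p x) y (- gap p y) x , eliminate S p x∈ y∈ ,
    sat-combine (orientAll A τ) (gap p x) y (- gap p y) x px (subst (0ℚ <_) (gap-flip p y) py) sy sx

  -- The question reduces to the deletion and the restriction. A region of `A` that meets the
  -- hyperplane of `p` has points on both sides; one that misses it lies on a single side, which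
  -- `realized-some` names.
  realized? : ∀ S A τ → Dec (Realized S A τ)
  realized? S []      []      = yes (zeros , inFlat-zeros S , [])
  realized? S (p ∷ A) (s ∷ τ) = helper (cuts? S p) (realized? (p ∷ S) A τ) (realized? S A τ)
    where
    helper : Cuts S p ⊎ Vanishes S p → Dec (Realized (p ∷ S) A τ) → Dec (Realized S A τ) →
      Dec (Realized S (p ∷ A) (s ∷ τ))
    helper (inj₂ van) _        _      = no (¬realized-vanishes {p = p} {s = s} van)
    helper (inj₁ c)   (yes r)  _      = yes (realized-both c r s)
    helper (inj₁ c)   (no _)   (no ¬r) = no (λ r → ¬r (realized-tail {p = p} {s = s} r))
    helper (inj₁ c)   (no ¬r′) (yes r) = helper′ s (realized-some c r)
      where
      helper′ : ∀ s → Realized S (p ∷ A) (true ∷ τ) ⊎ Realized S (p ∷ A) (false ∷ τ) → Dec (Realized S (p ∷ A) (s ∷ τ))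
      helper′ true  (inj₁ t) = yes t
      helper′ true  (inj₂ f) = no (λ t → ¬r′ (realized-meet t f))
      helper′ false (inj₁ t) = no (λ f → ¬r′ (realized-meet t f))
      helper′ false (inj₂ f) = yes f

  regions : List (Pair d) → List (Pair d) → ℕ
  regions S A = Σ𝔹 (length A) (λ τ → ind (realized? S A τ))

  regions-vanishes : ∀ {S p} A → Vanishes S p → regions S (p ∷ A) ≡ 0
  regions-vanishes {S} {p} A van = Σ𝔹-0 (suc (length A)) {λ τ → ind (realized? S (p ∷ A) τ)}
    λ { (s ∷ τ) → ind-no (realized? S (p ∷ A) (s ∷ τ)) (¬realized-vanishes {p = p} {s = s} van) }

  -- Each region of `A` split by the hyperplane of `p` counts once more than before, and its trace
  -- is a region of the restriction.
  regions-cuts : ∀ {S p} A → Cuts S p → regions S (p ∷ A) ≡ regions S A ℕ.+ regions (p ∷ S) A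
  regions-cuts {S} {p} A c = trans (Σ𝔹-+ (length A) _ _) (trans
    (Σ𝔹-cong (length A) (λ τ → ind-inclusion-exclusion
      (realized? S (p ∷ A) (true ∷ τ)) (realized? S (p ∷ A) (false ∷ τ)) (realized? S A τ) (realized? (p ∷ S) A τ)
      (realized-tail {p = p} {s = true}) (realized-tail {p = p} {s = false}) (realized-some c)
      (λ r → realized-both c r true) (λ r → realized-both c r false) realized-meet))
    (sym (Σ𝔹-+ (length A) _ _)))

-- Möbius function of the lattice of flats

Σℤ-cong : ∀ n {f g : Fin n → ℤ} → (∀ i → f i ≡ g i) → Σℤ n f ≡ Σℤ n g
Σℤ-cong zero    h = refl
Σℤ-cong (suc n) h = cong₂ ℤ._+_ (h Fin.zero) (Σℤ-cong n (λ i → h (Fin.suc i)))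

Σℤ-+ : ∀ n (f g : Fin n → ℤ) → Σℤ n (λ i → f i ℤ.+ g i) ≡ Σℤ n f ℤ.+ Σℤ n g
Σℤ-+ zero    f g = refl
Σℤ-+ (suc n) f g = trans (cong (λ s → f Fin.zero ℤ.+ g Fin.zero ℤ.+ s) (Σℤ-+ n _ _)) (ℤ-interchange (f Fin.zero) _ _ _)

Σℤ-0 : ∀ n {f : Fin n → ℤ} → (∀ i → f i ≡ + 0) → Σℤ n f ≡ + 0
Σℤ-0 zero    h = refl
Σℤ-0 (suc n) h = cong₂ ℤ._+_ (h Fin.zero) (Σℤ-0 n (λ i → h (Fin.suc i)))

Σℤ-neg : ∀ n (f : Fin n → ℤ) → Σℤ n (λ i → ℤ.- f i) ≡ ℤ.- Σℤ n f
Σℤ-neg zero    f = refl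
Σℤ-neg (suc n) f = trans (cong (λ s → ℤ.- f Fin.zero ℤ.+ s) (Σℤ-neg n _)) (sym (ℤP.neg-distrib-+ (f Fin.zero) _))

Σℤ-single : ∀ n (k : Fin n) {f : Fin n → ℤ} → (∀ i → i ≢ k → f i ≡ + 0) → Σℤ n f ≡ f k
Σℤ-single (suc n) Fin.zero    {f} h = trans (cong (λ s → f Fin.zero ℤ.+ s) (Σℤ-0 n (λ i → h (Fin.suc i) (λ ()))))
  (ℤP.+-identityʳ (f Fin.zero))
Σℤ-single (suc n) (Fin.suc k) {f} h = trans (cong₂ ℤ._+_ (h Fin.zero (λ ()))
    (Σℤ-single n k (λ i i≢k → h (Fin.suc i) (λ e → i≢k (FinP.suc-injective e)))))
  (ℤP.+-identityˡ (f (Fin.suc k)))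

Σℕ-cong : ∀ n {f g : Fin n → ℕ} → (∀ i → f i ≡ g i) → Σℕ n f ≡ Σℕ n g
Σℕ-cong zero    h = refl
Σℕ-cong (suc n) h = cong₂ ℕ._+_ (h Fin.zero) (Σℕ-cong n (λ i → h (Fin.suc i)))

Σℕ-+ : ∀ n (f g : Fin n → ℕ) → Σℕ n (λ i → f i ℕ.+ g i) ≡ Σℕ n f ℕ.+ Σℕ n g
Σℕ-+ zero    f g = refl
Σℕ-+ (suc n) f g = trans (cong (λ s → f Fin.zero ℕ.+ g Fin.zero ℕ.+ s) (Σℕ-+ n _ _)) (ℕ-interchange (f Fin.zero) _ _ _)

Σℕ-0 : ∀ n {f : Fin n → ℕ} → (∀ i → f i ≡ 0) → Σℕ n f ≡ 0
Σℕ-0 zero    h = refl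
Σℕ-0 (suc n) h = cong₂ ℕ._+_ (h Fin.zero) (Σℕ-0 n (λ i → h (Fin.suc i)))

Σℕ-ind≟ : ∀ {n} (k : Fin n) → Σℕ n (λ i → ind (k Fin.≟ i)) ≡ 1
Σℕ-ind≟ {suc n} Fin.zero    = cong suc (Σℕ-0 n (λ i → ind-no (Fin.zero Fin.≟ Fin.suc i) (λ ())))
Σℕ-ind≟ {suc n} (Fin.suc k) = trans
  (Σℕ-cong n (λ i → helper i (k Fin.≟ i))) (Σℕ-ind≟ k)
  where
  helper : ∀ i (D : Dec (k ≡ i)) → ind (Fin.suc k Fin.≟ Fin.suc i) ≡ ind D
  helper i (yes e) = ind-yes (Fin.suc k Fin.≟ Fin.suc i) (cong Fin.suc e)
  helper i (no ne) = ind-no (Fin.suc k Fin.≟ Fin.suc i) (λ e → ne (FinP.suc-injective e))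

belowSum : ∀ {n} → (Fin n → Fin n → Bool) → (Fin n → ℤ) → Fin n → ℤ
belowSum {n} le f w = Σℤ n (λ v → if le v w then f v else + 0)

belowSum-split : ∀ {n} (le : Fin n → Fin n → Bool) f w → le w w ≡ true →
  belowSum le f w ≡ strictBelowSum le f w ℤ.+ f w
belowSum-split {n} le f w refl-w = begin
  Σℤ n (λ v → if le v w then f v else + 0)
    ≡⟨ Σℤ-cong n (λ v → pointwise v (v Fin.≟ w)) ⟩
  Σℤ n (λ v → strict v ℤ.+ at v)
    ≡⟨ Σℤ-+ n strict at ⟩
  Σℤ n strict ℤ.+ Σℤ n at
    ≡⟨ cong (λ s → Σℤ n strict ℤ.+ s) (trans (Σℤ-single n w (λ v → off v (v Fin.≟ w))) (on (w Fin.≟ w))) ⟩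
  Σℤ n strict ℤ.+ f w ∎
  where
  open ≡-Reasoning
  strict at : Fin n → ℤ
  strict v = if le v w ∧ not (does (v Fin.≟ w)) then f v else + 0
  at v = if does (v Fin.≟ w) then f v else + 0
  pointwise : ∀ v (D : Dec (v ≡ w)) → (if le v w then f v else + 0) ≡
    (if le v w ∧ not (does D) then f v else + 0) ℤ.+ (if does D then f v else + 0)
  pointwise v (yes refl) rewrite refl-w = sym (ℤP.+-identityˡ (f v))
  pointwise v (no _) with le v w
  ... | true  = sym (ℤP.+-identityʳ (f v))
  ... | false = refl
  off : ∀ v (D : Dec (v ≡ w)) → v ≢ w → (if does D then f v else + 0) ≡ + 0
  off v (yes e) ne = contradiction e ne
  off v (no _)  _  = refl
  on : (D : Dec (w ≡ w)) → (if does D then f w else + 0) ≡ f w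
  on (yes _) = refl
  on (no ne) = contradiction refl ne

strictBelowSum-cong : ∀ {n} (le : Fin n → Fin n → Bool) {f g} w →
  (∀ v → le v w ≡ true → v ≢ w → f v ≡ g v) → strictBelowSum le f w ≡ strictBelowSum le g w
strictBelowSum-cong {n} le {f} {g} w h = Σℤ-cong n (λ v → pointwise v (le v w) refl (v Fin.≟ w))
  where
  pointwise : ∀ v b → le v w ≡ b → (D : Dec (v ≡ w)) →
    (if b ∧ not (does D) then f v else + 0) ≡ (if b ∧ not (does D) then g v else + 0)
  pointwise v false _ _        = refl
  pointwise v true  _ (yes _)  = refl
  pointwise v true  l (no v≢w) = h v l v≢w

-- All that is used of 𝓛 is phrased in the direction space: inclusion of flats, and an index `idx S`
-- for the flat cut out by an arbitrary list. Positivity and P° no longer occur.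
module FlatLattice {d m n : ℕ} (F : System d m) (us : Fin n → List (Pair d))
  (idx : List (Pair d) → Fin n)
  (sub-idx : ∀ S → Flats.Sub F S (us (idx S)))
  (idx-sub : ∀ S → Flats.Sub F (us (idx S)) S)
  (us-injective : ∀ i j → Flats.Sub F (us i) (us j) → Flats.Sub F (us j) (us i) → i ≡ j)
  (z : Fin n) (z-bottom : Flats.Sub F [] (us z))
  (le : Fin n → Fin n → Bool)
  (le-sub : ∀ v w → le v w ≡ true ⇔ Flats.Sub F (us w) (us v))
  (μ : Fin n → ℤ) (isMobius : IsMobiusFromBottom le z μ)
  where

  open Flats F
  open Regions F

  idx-cong : ∀ {S S′} → Sub S S′ → Sub S′ S → idx S ≡ idx S′
  idx-cong {S} {S′} s s′ = us-injective (idx S) (idx S′)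
    (λ v v∈ → sub-idx S′ v (inFlat-sub s (inFlat-sub (idx-sub S) v∈)))
    (λ v v∈ → sub-idx S v (inFlat-sub s′ (inFlat-sub (idx-sub S′) v∈)))

  le-idx : ∀ S w → le (idx S) w ≡ true ⇔ Sub (us w) S
  le-idx S w = mk⇔
    (λ l v v∈ → idx-sub S v (inFlat-sub (to (le-sub (idx S) w) l) v∈))
    (λ s → from (le-sub (idx S) w) (λ v v∈ → sub-idx S v (inFlat-sub s v∈)))

  le-refl : ∀ w → le w w ≡ true
  le-refl w = from (le-sub w w) (λ v → proj₂)

  ≤z⇒≡z : ∀ v → le v z ≡ true → v ≡ z
  ≤z⇒≡z v l = us-injective v z (λ y y∈ → z-bottom y (proj₁ y∈ , [])) (to (le-sub v z) l)

  belowSum-μ : ∀ w → belowSum le μ w ≡ + ind (w Fin.≟ z)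
  belowSum-μ w = trans (belowSum-split le μ w (le-refl w)) (helper w (w Fin.≟ z))
    where
    helper : ∀ w (D : Dec (w ≡ z)) → strictBelowSum le μ w ℤ.+ μ w ≡ + ind D
    helper w (yes refl) = cong₂ ℤ._+_
      (trans (strictBelowSum-cong le {μ} {λ _ → + 0} z (λ v l v≢z → contradiction (≤z⇒≡z v l) v≢z))
        (Σℤ-0 n (λ v → if-0 (le v z ∧ not (does (v Fin.≟ z))))))
      (proj₁ isMobius)
      where
      if-0 : ∀ b → (if b then + 0 else + 0) ≡ + 0
      if-0 true  = refl
      if-0 false = refl
    helper w (no w≢z) = trans (cong (λ s → strictBelowSum le μ w ℤ.+ s) (proj₂ isMobius w w≢z))
      (ℤP.+-inverseʳ (strictBelowSum le μ w))

  -- The contribution to the flat i of the subsets T of A in Whitney's formula: the sum of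
  -- (-1)^|T| over those T for which the flat cut out by S and T is i.
  whitney : List (Pair d) → List (Pair d) → Fin n → ℤ
  whitney S []      i = + ind (idx S Fin.≟ i)
  whitney S (p ∷ A) i = whitney S A i ℤ.- whitney (p ∷ S) A i

  -- The same recursion without cancellation.
  unsigned : List (Pair d) → List (Pair d) → Fin n → ℕ
  unsigned S []      i = ind (idx S Fin.≟ i)
  unsigned S (p ∷ A) i = [ (λ _ → unsigned S A i ℕ.+ unsigned (p ∷ S) A i) , (λ _ → 0) ] (cuts? S p)

  unsigned-cuts : ∀ {S p} A i → Cuts S p → unsigned S (p ∷ A) i ≡ unsigned S A i ℕ.+ unsigned (p ∷ S) A i
  unsigned-cuts {S} {p} A i c with cuts? S p
  ... | inj₁ _   = refl
  ... | inj₂ van = contradiction van (cuts⇒¬vanishes c)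

  unsigned-vanishes : ∀ {S p} A i → Vanishes S p → unsigned S (p ∷ A) i ≡ 0
  unsigned-vanishes {S} {p} A i van with cuts? S p
  ... | inj₁ c = contradiction van (cuts⇒¬vanishes c)
  ... | inj₂ _ = refl

  whitney-cong : ∀ A i {S S′} → Sub S S′ → Sub S′ S → whitney S A i ≡ whitney S′ A i
  whitney-cong []      i s s′ = cong (λ k → + ind (k Fin.≟ i)) (idx-cong s s′)
  whitney-cong (p ∷ A) i s s′ = cong₂ ℤ._-_ (whitney-cong A i s s′)
    (whitney-cong A i (sub-cons {p} s) (sub-cons {p} s′))

  -- The prefactor is the parity of the codimension of the flat `i` relative to `S`. If `p` cuts
  -- `S`, the minus sign of the recursion is absorbed by the flip of `sgn`; if `p` vanishes on `S`,
  -- the two Whitney terms are equal and cancel.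
  whitney-sign : ∀ A i S → whitney S A i ≡ (sgn S ℤ.* sgn (us i)) ℤ.* + unsigned S A i
  whitney-sign [] i S = helper (idx S Fin.≟ i)
    where
    helper : (D : Dec (idx S ≡ i)) → + ind D ≡ (sgn S ℤ.* sgn (us i)) ℤ.* + ind D
    helper (yes refl) = sym (trans (ℤP.*-identityʳ _) (trans
      (cong (λ s → sgn S ℤ.* s) (sgn-cong (idx-sub S) (sub-idx S))) (sgn² S)))
    helper (no _) = sym (ℤP.*-zeroʳ (sgn S ℤ.* sgn (us i)))
  whitney-sign (p ∷ A) i S = helper (cuts? S p)
    where
    algebra : ∀ s t a b → (s ℤ.* t) ℤ.* a ℤ.- (ℤ.- s ℤ.* t) ℤ.* b ≡ (s ℤ.* t) ℤ.* (a ℤ.+ b)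
    algebra = solve-∀
    helper : Cuts S p ⊎ Vanishes S p →
      whitney S (p ∷ A) i ≡ (sgn S ℤ.* sgn (us i)) ℤ.* + unsigned S (p ∷ A) i
    helper (inj₁ c) = begin
      whitney S A i ℤ.- whitney (p ∷ S) A i
        ≡⟨ cong₂ ℤ._-_ (whitney-sign A i S) (whitney-sign A i (p ∷ S)) ⟩
      (sgn S ℤ.* sgn (us i)) ℤ.* + unsigned S A i ℤ.- (sgn (p ∷ S) ℤ.* sgn (us i)) ℤ.* + unsigned (p ∷ S) A i
        ≡⟨ cong (λ s → (sgn S ℤ.* sgn (us i)) ℤ.* + unsigned S A i ℤ.- (s ℤ.* sgn (us i)) ℤ.* + unsigned (p ∷ S) A i) (sgn-cuts c) ⟩
      (sgn S ℤ.* sgn (us i)) ℤ.* + unsigned S A i ℤ.- (ℤ.- sgn S ℤ.* sgn (us i)) ℤ.* + unsigned (p ∷ S) A i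
        ≡⟨ algebra (sgn S) (sgn (us i)) (+ unsigned S A i) (+ unsigned (p ∷ S) A i) ⟩
      (sgn S ℤ.* sgn (us i)) ℤ.* + (unsigned S A i ℕ.+ unsigned (p ∷ S) A i)
        ≡⟨ cong (λ k → (sgn S ℤ.* sgn (us i)) ℤ.* + k) (sym (unsigned-cuts A i c)) ⟩
      (sgn S ℤ.* sgn (us i)) ℤ.* + unsigned S (p ∷ A) i ∎
      where open ≡-Reasoning
    helper (inj₂ van) = trans
      (ℤP.i≡j⇒i-j≡0 (whitney-cong A i (sub-vanishes van) (sub-tail {p})))
      (sym (trans (cong (λ k → (sgn S ℤ.* sgn (us i)) ℤ.* + k) (unsigned-vanishes A i van))
        (ℤP.*-zeroʳ (sgn S ℤ.* sgn (us i)))))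

  ∣sgn∣ : ∀ S → ℤ.∣ sgn S ∣ ≡ 1
  ∣sgn∣ S = ℕP.m*n≡1⇒m≡1 _ _ (trans (sym (ℤP.abs-* (sgn S) (sgn S))) (cong ℤ.∣_∣ (sgn² S)))

  ∣whitney∣ : ∀ S A i → ℤ.∣ whitney S A i ∣ ≡ unsigned S A i
  ∣whitney∣ S A i = begin
    ℤ.∣ whitney S A i ∣
      ≡⟨ cong ℤ.∣_∣ (whitney-sign A i S) ⟩
    ℤ.∣ (sgn S ℤ.* sgn (us i)) ℤ.* + unsigned S A i ∣
      ≡⟨ ℤP.abs-* (sgn S ℤ.* sgn (us i)) _ ⟩
    ℤ.∣ sgn S ℤ.* sgn (us i) ∣ ℕ.* unsigned S A i
      ≡⟨ cong (ℕ._* unsigned S A i) (trans (ℤP.abs-* (sgn S) _) (cong₂ ℕ._*_ (∣sgn∣ S) (∣sgn∣ (us i)))) ⟩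
    1 ℕ.* unsigned S A i
      ≡⟨ ℕP.*-identityˡ _ ⟩
    unsigned S A i ∎
    where open ≡-Reasoning

  -- Summed over the flats, `unsigned` obeys the recursion of `regions-cuts`. For empty `A` the flat
  -- of `S` is a single region and has a single index.
  Σ-unsigned : ∀ S A → Σℕ n (unsigned S A) ≡ regions S A
  Σ-unsigned S []      = Σℕ-ind≟ (idx S)
  Σ-unsigned S (p ∷ A) = helper (cuts? S p)
    where
    helper : Cuts S p ⊎ Vanishes S p → Σℕ n (unsigned S (p ∷ A)) ≡ regions S (p ∷ A)
    helper (inj₁ c) = trans (Σℕ-cong n (λ i → unsigned-cuts A i c)) (trans
      (Σℕ-+ n (unsigned S A) (unsigned (p ∷ S) A)) (trans
      (cong₂ ℕ._+_ (Σ-unsigned S A) (Σ-unsigned (p ∷ S) A)) (sym (regions-cuts A c))))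
    helper (inj₂ van) = trans (Σℕ-0 n (λ i → unsigned-vanishes A i van)) (sym (regions-vanishes A van))

  -- The signed count of the subsets T of `A` for which the flat of `S` and T contains `us w`.
  whitneyBelow : List (Pair d) → List (Pair d) → Fin n → ℤ
  whitneyBelow S A w = belowSum le (whitney S A) w

  whitneyBelow-cons : ∀ S p A w → whitneyBelow S (p ∷ A) w ≡ whitneyBelow S A w ℤ.- whitneyBelow (p ∷ S) A w
  whitneyBelow-cons S p A w = trans (Σℤ-cong n (λ v → pointwise (le v w) v)) (trans
    (Σℤ-+ n _ _) (cong (λ s → whitneyBelow S A w ℤ.+ s) (Σℤ-neg n _)))
    where
    pointwise : ∀ b v → (if b then whitney S (p ∷ A) v else + 0) ≡
      (if b then whitney S A v else + 0) ℤ.+ ℤ.- (if b then whitney (p ∷ S) A v else + 0)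
    pointwise true  v = refl
    pointwise false v = refl

  whitneyBelow-[] : ∀ S w → whitneyBelow S [] w ≡ (if le (idx S) w then + 1 else + 0)
  whitneyBelow-[] S w = trans (Σℤ-single n (idx S) (λ v v≢ → off (le v w) v (idx S Fin.≟ v) v≢))
    (on (le (idx S) w))
    where
    off : ∀ b v (D : Dec (idx S ≡ v)) → v ≢ idx S → (if b then + ind D else + 0) ≡ + 0
    off false v D        ne = refl
    off true  v (yes e)  ne = contradiction (sym e) ne
    off true  v (no _)   ne = refl
    on : ∀ b → (if b then + ind (idx S Fin.≟ idx S) else + 0) ≡ (if b then + 1 else + 0)
    on false = refl
    on true  = cong +_ (ind-yes (idx S Fin.≟ idx S) refl)

  -- The flat of `S` and T contains `us w` exactly when the flats of `S` and of T both do, so `S`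
  -- enters only through whether its own flat does.
  whitneyBelow-cong : ∀ A w {S S′} → (Sub (us w) S → Sub (us w) S′) → (Sub (us w) S′ → Sub (us w) S) →
    whitneyBelow S A w ≡ whitneyBelow S′ A w
  whitneyBelow-cong [] w {S} {S′} f g = trans (whitneyBelow-[] S w) (trans
    (cong (λ b → if b then + 1 else + 0) (bool-ext (le (idx S) w) (le (idx S′) w)
      (λ e → from (le-idx S′ w) (f (to (le-idx S w) e))) (λ e → from (le-idx S w) (g (to (le-idx S′ w) e)))))
    (sym (whitneyBelow-[] S′ w)))
    where
    bool-ext : ∀ b b′ → (b ≡ true → b′ ≡ true) → (b′ ≡ true → b ≡ true) → b ≡ b′
    bool-ext true  b′    f g = sym (f refl)
    bool-ext false true  f g = g refl
    bool-ext false false f g = refl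
  whitneyBelow-cong (p ∷ A) w {S} {S′} f g = trans (whitneyBelow-cons S p A w) (trans
    (cong₂ ℤ._-_ (whitneyBelow-cong A w f g) (whitneyBelow-cong A w {p ∷ S} {p ∷ S′} (lift f) (lift g)))
    (sym (whitneyBelow-cons S′ p A w)))
    where
    lift : ∀ {T T′} → (Sub (us w) T → Sub (us w) T′) → Sub (us w) (p ∷ T) → Sub (us w) (p ∷ T′)
    lift h s v v∈ = All.head (s v v∈) ∷ h (λ u u∈ → All.tail (s u u∈)) v v∈

  -- Toggling p pairs off the subsets of A.
  whitneyBelow-0 : ∀ {p} A w S → p ∈ A → Vanishes (us w) p → whitneyBelow S A w ≡ + 0
  whitneyBelow-0 (q ∷ A) w S (here refl) van = trans (whitneyBelow-cons S q A w)
    (ℤP.i≡j⇒i-j≡0 (whitneyBelow-cong A w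
      (λ s v v∈ → gap≡0⇒≡ q v (van v v∈) ∷ s v v∈) (λ s v v∈ → All.tail (s v v∈))))
  whitneyBelow-0 (q ∷ A) w S (there p∈A) van = trans (whitneyBelow-cons S q A w)
    (cong₂ ℤ._-_ (whitneyBelow-0 A w S p∈A van) (whitneyBelow-0 A w (q ∷ S) p∈A van))

  whitney-bottom-0 : ∀ A S → ¬ Sub [] S → whitney S A z ≡ + 0
  whitney-bottom-0 [] S ¬sub = cong +_ (ind-no (idx S Fin.≟ z)
    (λ { refl → ¬sub (λ v v∈ → idx-sub S v (inFlat-sub z-bottom v∈)) }))
  whitney-bottom-0 (p ∷ A) S ¬sub = cong₂ ℤ._-_ (whitney-bottom-0 A S ¬sub)
    (whitney-bottom-0 A (p ∷ S) (λ s → ¬sub (λ v v∈ → All.tail (s v v∈))))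

  -- Only the empty subset contributes: each pair of `A` cuts the whole space, and further pairs
  -- never restore it.
  whitney-bottom : ∀ {A} → All (Cuts []) A → whitney [] A z ≡ + 1
  whitney-bottom [] = cong +_ (ind-yes (idx [] Fin.≟ z)
    (us-injective (idx []) z (λ v v∈ → z-bottom v (proj₁ v∈ , [])) (λ v v∈ → sub-idx [] v (proj₁ v∈ , []))))
  whitney-bottom {p ∷ A} (c ∷ cs) = cong₂ ℤ._-_ (whitney-bottom cs)
    (whitney-bottom-0 A (p ∷ []) (λ s → cuts⇒¬vanishes c (λ v v∈ → ≡⇒gap≡0 p v (All.head (s v v∈)))))

  infix 4 _⊏_
  _⊏_ : Fin n → Fin n → Set
  v ⊏ w = le v w ≡ true × v ≢ w

  le-trans : ∀ {u v w} → le u v ≡ true → le v w ≡ true → le u w ≡ true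
  le-trans {u} {v} {w} l l′ = from (le-sub u w) (λ y y∈ → to (le-sub u v) l y (inFlat-sub (to (le-sub v w) l′) y∈))

  le-antisym : ∀ {v w} → le v w ≡ true → le w v ≡ true → v ≡ w
  le-antisym {v} {w} l l′ = us-injective v w (to (le-sub w v) l′) (to (le-sub v w) l)

  ⊏-isStrictPartialOrder : IsStrictPartialOrder _≡_ _⊏_
  ⊏-isStrictPartialOrder = record
    { isEquivalence = Eq.isEquivalence
    ; irrefl        = λ e (_ , ne) → ne e
    ; trans         = λ { (l , ne) (l′ , _) → le-trans l l′ , λ { refl → ne (le-antisym l l′) } }
    ; <-resp-≈      = (λ { refl p → p }) , (λ { refl p → p })
    }

  module _ (u : Vec ℚ d) (u∈ : Dir F u) (A : List (Pair d)) (A-cuts : All (Cuts []) A)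
    (A-on : OnFlat A u) (A-all : ∀ w → w ≢ z → OnFlat (us w) u → ∃ λ p → p ∈ A × Vanishes (us w) p) where

    -- Whitney's sum obeys the recursion of `μ`: by `A-all` some pair of `A` vanishes on `us w`,
    -- which makes the sum over all flats up to `w` zero. The flats below `w` contain `us w`, so the
    -- induction stays among flats through `u`.
    whitney≡μ : ∀ w → Acc _⊏_ w → OnFlat (us w) u → whitney [] A w ≡ μ w
    whitney≡μ w (acc rec) on = helper (w Fin.≟ z)
      where
      open ≡-Reasoning
      helper : Dec (w ≡ z) → whitney [] A w ≡ μ w
      helper (yes refl) = trans (whitney-bottom A-cuts) (sym (proj₁ isMobius))
      helper (no w≢z) = let p , p∈A , van = A-all w w≢z on in begin
        whitney [] A w
          ≡⟨ isolate (strictBelowSum le (whitney [] A) w) (whitney [] A w) ⟩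
        (strictBelowSum le (whitney [] A) w ℤ.+ whitney [] A w) ℤ.- strictBelowSum le (whitney [] A) w
          ≡⟨ cong (ℤ._- strictBelowSum le (whitney [] A) w)
               (trans (sym (belowSum-split le (whitney [] A) w (le-refl w))) (whitneyBelow-0 A w [] p∈A van)) ⟩
        + 0 ℤ.- strictBelowSum le (whitney [] A) w
          ≡⟨ ℤP.+-identityˡ _ ⟩
        ℤ.- strictBelowSum le (whitney [] A) w
          ≡⟨ cong ℤ.-_ (strictBelowSum-cong le w (λ v l v≢w →
               whitney≡μ v (rec (l , v≢w)) (to (le-sub v w) l u (u∈ , on)))) ⟩
        ℤ.- strictBelowSum le μ w
          ≡⟨ sym (proj₂ isMobius w w≢z) ⟩
        μ w ∎
        where
        isolate : ∀ s x → x ≡ (s ℤ.+ x) ℤ.- s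
        isolate = solve-∀

    -- All pairs in `S` and `B` are tied at `u`, so every flat they cut out passes through `u`.
    whitney-off : ∀ B S i → InFlat S u → OnFlat B u → ¬ OnFlat (us i) u → whitney S B i ≡ + 0
    whitney-off []      S i uS []       ¬on = cong +_ (ind-no (idx S Fin.≟ i) (λ { refl → ¬on (sub-idx S u uS) }))
    whitney-off (p ∷ B) S i uS (e ∷ es) ¬on = cong₂ ℤ._-_ (whitney-off B S i uS es ¬on)
      (whitney-off B (p ∷ S) i (proj₁ uS , e ∷ proj₂ uS) es ¬on)

    Σ∣μ∣≡regions : {On : Fin n → Set} (On? : ∀ i → Dec (On i)) → (∀ i → On i ⇔ OnFlat (us i) u) →
      Σℕ n (λ i → ∣ μ i ∣ ℕ.* ind (On? i)) ≡ regions [] A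
    Σ∣μ∣≡regions On? eqv = trans (Σℕ-cong n (λ i → pointwise i (On? i))) (Σ-unsigned [] A)
      where
      pointwise : ∀ i (D : Dec _) → ∣ μ i ∣ ℕ.* ind D ≡ unsigned [] A i
      pointwise i (yes on) = trans (ℕP.*-identityʳ _) (trans
        (cong ℤ.∣_∣ (sym (whitney≡μ i (spo-wellFounded ⊏-isStrictPartialOrder i) (to (eqv i) on)))) (∣whitney∣ [] A i))
      pointwise i (no ¬on) = trans (ℕP.*-zeroʳ ∣ μ i ∣) (trans
        (cong ℤ.∣_∣ (sym (whitney-off A [] i (u∈ , []) A-on (λ o → ¬on (from (eqv i) o))))) (∣whitney∣ [] A i))

-- Counting

unique-lookup-injective : ∀ {A : Set} {xs : List A} → Unique xs → Injective _≡_ _≡_ (List.lookup xs)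
unique-lookup-injective (_  ∷ _) {Fin.zero}  {Fin.zero}  _ = refl
unique-lookup-injective (ne ∷ _) {Fin.zero}  {Fin.suc j} e = contradiction e (All.lookup ne (∈-lookup j))
unique-lookup-injective (ne ∷ _) {Fin.suc i} {Fin.zero}  e = contradiction (sym e) (All.lookup ne (∈-lookup i))
unique-lookup-injective (_  ∷ u) {Fin.suc i} {Fin.suc j} e = cong Fin.suc (unique-lookup-injective u e)

-- A pigeonhole principle for choices that may depend on the membership proof. Used in both
-- directions it compares permutations with regions without constructing mutually inverse functions.
length-≤-relation : ∀ {A B : Set} (R : A → B → Set) {xs : List A} {ys : List B} → Unique xs →
  (∀ {x} → x ∈ xs → ∃ λ y → y ∈ ys × R x y) →
  (∀ {x x′ y} → x ∈ xs → x′ ∈ xs → R x y → R x′ y → x ≡ x′) → length xs ℕ.≤ length ys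
length-≤-relation R {xs} {ys} u total inj = FinP.injective⇒≤ {f = f} f-injective
  where
  image = λ i → total (∈-lookup {xs = xs} i)
  f : Fin (length xs) → Fin (length ys)
  f i = Any.index (proj₁ (proj₂ (image i)))
  R-f : ∀ i → R (List.lookup xs i) (List.lookup ys (f i))
  R-f i = subst (R (List.lookup xs i)) (lookup-index (proj₁ (proj₂ (image i)))) (proj₂ (proj₂ (image i)))
  f-injective : Injective _≡_ _≡_ f
  f-injective {i} {j} e = unique-lookup-injective u (inj (∈-lookup i) (∈-lookup j) (R-f i)
    (subst (λ k → R (List.lookup xs j) (List.lookup ys k)) (sym e) (R-f j)))

unique-length-≤ : ∀ {A : Set} {xs ys : List A} → Unique xs → (∀ {x} → x ∈ xs → x ∈ ys) → length xs ℕ.≤ length ys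
unique-length-≤ u sub = length-≤-relation _≡_ u (λ x∈ → _ , sub x∈ , refl) (λ { _ _ refl refl → refl })

Σₗ : ∀ {A : Set} → List A → (A → ℕ) → ℕ
Σₗ []       f = 0
Σₗ (x ∷ xs) f = f x ℕ.+ Σₗ xs f

Σₗ-cong : ∀ {A : Set} (xs : List A) {f g : A → ℕ} → (∀ {x} → x ∈ xs → f x ≡ g x) → Σₗ xs f ≡ Σₗ xs g
Σₗ-cong []       h = refl
Σₗ-cong (x ∷ xs) h = cong₂ ℕ._+_ (h (here refl)) (Σₗ-cong xs (λ x∈ → h (there x∈)))

Σₗ-0 : ∀ {A : Set} (xs : List A) {f : A → ℕ} → (∀ {x} → x ∈ xs → f x ≡ 0) → Σₗ xs f ≡ 0
Σₗ-0 []       h = refl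
Σₗ-0 (x ∷ xs) h = cong₂ ℕ._+_ (h (here refl)) (Σₗ-0 xs (λ x∈ → h (there x∈)))

Σₗ-+ : ∀ {A : Set} (xs : List A) (f g : A → ℕ) → Σₗ xs (λ x → f x ℕ.+ g x) ≡ Σₗ xs f ℕ.+ Σₗ xs g
Σₗ-+ []       f g = refl
Σₗ-+ (x ∷ xs) f g = trans (cong (λ s → f x ℕ.+ g x ℕ.+ s) (Σₗ-+ xs f g)) (ℕ-interchange (f x) _ _ _)

length-filter≡Σ : ∀ {A : Set} {P : A → Set} (P? : ∀ a → Dec (P a)) xs →
  length (filter P? xs) ≡ Σₗ xs (λ x → ind (P? x))
length-filter≡Σ P? []       = refl
length-filter≡Σ P? (x ∷ xs) with P? x
... | yes _ = cong suc (length-filter≡Σ P? xs)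
... | no _  = length-filter≡Σ P? xs

-- Expresses a count by indicators over a list shared by all the flats, so that summation over
-- points and over flats can be interchanged.
hasCard-Σ : ∀ {A : Set} {P Q : A → Set} {n} (Q? : ∀ a → Dec (Q a)) {xs} → Unique xs →
  (∀ a → P a ⇔ (a ∈ xs × Q a)) → HasCard P n → n ≡ Σₗ xs (λ x → ind (Q? x))
hasCard-Σ {P = P} {Q} Q? {xs} u eqv (ys , uys , mem , refl) = trans
  (ℕP.≤-antisym
    (unique-length-≤ uys (λ {a} a∈ → let a∈xs , q = to (eqv a) (to (mem a) a∈) in ∈-filter⁺ Q? a∈xs q))
    (unique-length-≤ (UniqueP.filter⁺ Q? u) (λ {a} a∈ → from (mem a) (from (eqv a) (∈-filter⁻ Q? a∈)))))
  (length-filter≡Σ Q? xs)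

Σₗ-ind≟ : ∀ {A : Set} (_≟_ : DecidableEquality A) {xs} → Unique xs → ∀ {a} → a ∈ xs → Σₗ xs (λ x → ind (a ≟ x)) ≡ 1
Σₗ-ind≟ _≟_ {x ∷ xs} (ne ∷ u) (here refl) = cong₂ ℕ._+_ (ind-yes (x ≟ x) refl)
  (Σₗ-0 xs (λ {y} y∈ → ind-no (x ≟ y) (All.lookup ne y∈)))
Σₗ-ind≟ _≟_ {x ∷ xs} (ne ∷ u) {a} (there a∈) = cong₂ ℕ._+_
  (ind-no (a ≟ x) (λ { refl → All.lookup ne a∈ refl })) (Σₗ-ind≟ _≟_ u a∈)

length-by-fibres : ∀ {A B : Set} (_≟_ : DecidableEquality B) (f : A → B) {ys} → Unique ys →
  ∀ xs → (∀ {x} → x ∈ xs → f x ∈ ys) → length xs ≡ Σₗ ys (λ y → length (filter (λ x → f x ≟ y) xs))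
length-by-fibres _≟_ f {ys} u []       h = sym (Σₗ-0 ys (λ _ → refl))
length-by-fibres _≟_ f {ys} u (x ∷ xs) h = sym (begin
  Σₗ ys (λ y → length (filter (λ x → f x ≟ y) (x ∷ xs)))
    ≡⟨ Σₗ-cong ys (λ {y} _ → trans (length-filter≡Σ (λ x → f x ≟ y) (x ∷ xs))
         (cong (λ s → ind (f x ≟ y) ℕ.+ s) (sym (length-filter≡Σ (λ x → f x ≟ y) xs)))) ⟩
  Σₗ ys (λ y → ind (f x ≟ y) ℕ.+ length (filter (λ x → f x ≟ y) xs))
    ≡⟨ Σₗ-+ ys _ _ ⟩
  Σₗ ys (λ y → ind (f x ≟ y)) ℕ.+ Σₗ ys (λ y → length (filter (λ x → f x ≟ y) xs))
    ≡⟨ cong₂ ℕ._+_ (Σₗ-ind≟ _≟_ u (h (here refl))) (sym (length-by-fibres _≟_ f u xs (λ x∈ → h (there x∈)))) ⟩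
  suc (length xs) ∎)
  where open ≡-Reasoning

Σℕ-Σₗ-swap : ∀ {A : Set} n (c : Fin n → ℕ) (f : Fin n → A → ℕ) xs →
  Σℕ n (λ i → c i ℕ.* Σₗ xs (f i)) ≡ Σₗ xs (λ x → Σℕ n (λ i → c i ℕ.* f i x))
Σℕ-Σₗ-swap n c f []       = Σℕ-0 n (λ i → ℕP.*-zeroʳ (c i))
Σℕ-Σₗ-swap n c f (x ∷ xs) = trans (Σℕ-cong n (λ i → ℕP.*-distribˡ-+ (c i) (f i x) (Σₗ xs (f i))))
  (trans (Σℕ-+ n _ _) (cong (λ s → Σℕ n (λ i → c i ℕ.* f i x) ℕ.+ s) (Σℕ-Σₗ-swap n c f xs)))

Σℤ-Σₗ : ∀ {A : Set} n (c : Fin n → ℤ) (f : Fin n → A → ℕ) (g : A → ℕ) xs →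
  (∀ {x} → x ∈ xs → Σℤ n (λ i → c i ℤ.* + f i x) ≡ + g x) → Σℤ n (λ i → c i ℤ.* + Σₗ xs (f i)) ≡ + Σₗ xs g
Σℤ-Σₗ n c f g []       h = Σℤ-0 n (λ i → ℤP.*-zeroʳ (c i))
Σℤ-Σₗ n c f g (x ∷ xs) h = trans (Σℤ-cong n (λ i → ℤP.*-distribˡ-+ (c i) (+ f i x) (+ Σₗ xs (f i))))
  (trans (Σℤ-+ n _ _) (cong₂ ℤ._+_ (h (here refl)) (Σℤ-Σₗ n c f g xs (λ x∈ → h (there x∈)))))

hasCard-Σ𝔹 : ∀ k {P : Vec Bool k → Set} (P? : ∀ τ → Dec (P τ)) → HasCard P (Σ𝔹 k (λ τ → ind (P? τ)))
hasCard-Σ𝔹 zero {P} P? = helper (P? [])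
  where
  helper : (D : Dec (P [])) → HasCard P (ind D)
  helper (yes p) = [] ∷ [] , [] ∷ [] , (λ { [] → mk⇔ (λ _ → p) (λ _ → here refl) }) , refl
  helper (no ¬p) = [] , [] , (λ { [] → mk⇔ (λ ()) (λ p → contradiction p ¬p) }) , refl
hasCard-Σ𝔹 (suc k) {P} P? = combine (hasCard-Σ𝔹 k (λ τ → P? (true ∷ τ))) (hasCard-Σ𝔹 k (λ τ → P? (false ∷ τ)))
  where
  combine : ∀ {a b} → HasCard (λ τ → P (true ∷ τ)) a → HasCard (λ τ → P (false ∷ τ)) b → HasCard P (a ℕ.+ b)
  combine (xs , ux , mx , refl) (ys , uy , my , refl) =
    List.map (true ∷_) xs ++ List.map (false ∷_) ys ,
    UniqueP.++⁺ (UniqueP.map⁺ ∷-inj ux) (UniqueP.map⁺ ∷-inj uy) disjoint ,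
    (λ τ → mk⇔ (fwd τ) (bwd τ)) ,
    trans (length-++ (List.map (true ∷_) xs)) (cong₂ ℕ._+_ (length-map _ xs) (length-map _ ys))
    where
    ∷-inj : ∀ {s : Bool} {τ τ′ : Vec Bool k} → s ∷ τ ≡ s ∷ τ′ → τ ≡ τ′
    ∷-inj refl = refl
    disjoint : ∀ {τ} → ¬ (τ ∈ List.map (true ∷_) xs × τ ∈ List.map (false ∷_) ys)
    disjoint (p , q) with ∈-map⁻ (true ∷_) p | ∈-map⁻ (false ∷_) q
    ... | _ , _ , refl | _ , _ , ()
    fwd : ∀ τ → τ ∈ List.map (true ∷_) xs ++ List.map (false ∷_) ys → P τ
    fwd τ τ∈ with ∈-++⁻ (List.map (true ∷_) xs) τ∈
    ... | inj₁ p with ∈-map⁻ (true ∷_) p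
    ...   | τ′ , τ′∈ , refl = to (mx τ′) τ′∈
    fwd τ τ∈ | inj₂ p with ∈-map⁻ (false ∷_) p
    ...   | τ′ , τ′∈ , refl = to (my τ′) τ′∈
    bwd : ∀ τ → P τ → τ ∈ List.map (true ∷_) xs ++ List.map (false ∷_) ys
    bwd (true  ∷ τ) p = ∈-++⁺ˡ (∈-map⁺ (true ∷_) (from (mx τ) p))
    bwd (false ∷ τ) p = ∈-++⁺ʳ (List.map (true ∷_) xs) (∈-map⁺ (false ∷_) (from (my τ) p))

-- Permutations sorting a vector

injective⇒surjective : ∀ {n} (f : Fin n → Fin n) → Injective _≡_ _≡_ f → ∀ j → ∃ λ i → f i ≡ j
injective⇒surjective {suc n} f inj j = helper (FinP.any? (λ i → f i Fin.≟ j))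
  where
  helper : Dec (∃ λ i → f i ≡ j) → ∃ λ i → f i ≡ j
  helper (yes hit) = hit
  -- A missed value could be removed from the codomain, leaving an injection into a set with one
  -- element fewer.
  helper (no miss) = contradiction (FinP.injective⇒≤ {f = λ i → Fin.punchOut (j≢f i)}
      (λ {i} {i′} e → inj (FinP.punchOut-injective (j≢f i) (j≢f i′) e))) ℕP.1+n≰n
    where
    j≢f : ∀ i → j ≢ f i
    j≢f i e = miss (i , sym e)

perm-surjective : ∀ {d} (σ : Vec (Fin d) d) → IsPerm σ → ∀ j → ∃ λ a → lookup σ a ≡ j
perm-surjective σ perm = injective⇒surjective (lookup σ) inj
  where
  inj : Injective _≡_ _≡_ (lookup σ)
  inj {a} {b} e with a Fin.≟ b
  ... | yes a≡b = a≡b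
  ... | no a≢b = contradiction e (perm a b a≢b)

StrictlyMonotone : ∀ {d} → (Fin d → Fin d) → Set
StrictlyMonotone π = ∀ {a b} → toℕ a ℕ.< toℕ b → toℕ (π a) ℕ.< toℕ (π b)

monotone-inflationary : ∀ {d} (π : Fin d → Fin d) → StrictlyMonotone π → ∀ a → toℕ a ℕ.≤ toℕ (π a)
monotone-inflationary {d} π mono a = go (toℕ a) a refl
  where
  go : ∀ k (a : Fin d) → toℕ a ≡ k → k ℕ.≤ toℕ (π a)
  go zero    a e = ℕ.z≤n
  go (suc k) a e = ℕP.≤-<-trans (go k a′ a′≡k) (mono a′<a)
    where
    k<d : k ℕ.< d
    k<d = ℕP.<-trans (subst (k ℕ.<_) (sym e) (ℕP.n<1+n k)) (FinP.toℕ<n a)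
    a′ : Fin d
    a′ = Fin.fromℕ< k<d
    a′≡k : toℕ a′ ≡ k
    a′≡k = FinP.toℕ-fromℕ< k<d
    a′<a : toℕ a′ ℕ.< toℕ a
    a′<a = subst₂ ℕ._<_ (sym a′≡k) (sym e) (ℕP.n<1+n k)

record Sorts {d : ℕ} (σ : Vec (Fin d) d) (v : Vec ℚ d) : Set where
  constructor mkSorts
  field
    increasing : ∀ a b → toℕ a ℕ.< toℕ b → lookup v (lookup σ a) ℚ.< lookup v (lookup σ b)

open Sorts

sorts-reflects : ∀ {d} {σ : Vec (Fin d) d} {v} → Sorts σ v → ∀ a b →
  lookup v (lookup σ a) ℚ.< lookup v (lookup σ b) → toℕ a ℕ.< toℕ b
sorts-reflects {σ = σ} {v} s a b lt with ℕP.<-cmp (toℕ a) (toℕ b)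
... | tri< a<b _ _ = a<b
... | tri≈ _ a≡b _ = contradiction (cong (λ c → lookup v (lookup σ c)) (FinP.toℕ-injective a≡b)) (ℚP.<⇒≢ lt)
... | tri> _ _ b<a = contradiction (increasing s b a b<a) (ℚP.<-asym lt)

-- The map from positions under `σ` to positions under `σ′` preserves the order of the values of
-- `v`. It and its inverse are strictly monotone, hence both inflationary, hence the identity.
sorts-unique : ∀ {d} {σ σ′ : Vec (Fin d) d} {v} → IsPerm σ → IsPerm σ′ → Sorts σ v → Sorts σ′ v → σ ≡ σ′
sorts-unique {d} {σ} {σ′} {v} perm perm′ s s′ = lookup-ext λ a →
  trans (sym (π-spec σ σ′ perm′ a)) (cong (lookup σ′) (sym (FinP.toℕ-injective (ℕP.≤-antisym
    (monotone-inflationary π₁ (π-mono σ σ′ perm′ s s′) a)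
    (subst (λ c → toℕ (π₁ a) ℕ.≤ toℕ c) (π₂π₁ a)
      (monotone-inflationary π₂ (π-mono σ′ σ perm s′ s) (π₁ a)))))))
  where
  lookup-ext : ∀ {A : Set} {n} {x y : Vec A n} → (∀ i → lookup x i ≡ lookup y i) → x ≡ y
  lookup-ext {x = []}    {[]}    h = refl
  lookup-ext {x = _ ∷ _} {_ ∷ _} h = cong₂ _∷_ (h Fin.zero) (lookup-ext (λ i → h (Fin.suc i)))
  π : (σ σ′ : Vec (Fin d) d) → IsPerm σ′ → Fin d → Fin d
  π σ σ′ perm′ a = proj₁ (perm-surjective σ′ perm′ (lookup σ a))
  π-spec : ∀ σ σ′ perm′ a → lookup σ′ (π σ σ′ perm′ a) ≡ lookup σ a
  π-spec σ σ′ perm′ a = proj₂ (perm-surjective σ′ perm′ (lookup σ a))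
  π-mono : ∀ σ σ′ perm′ → Sorts σ v → Sorts σ′ v → StrictlyMonotone (π σ σ′ perm′)
  π-mono σ σ′ perm′ s s′ {a} {b} a<b = sorts-reflects s′ _ _
    (subst₂ (λ j k → lookup v j ℚ.< lookup v k) (sym (π-spec σ σ′ perm′ a)) (sym (π-spec σ σ′ perm′ b)) (increasing s a b a<b))
  π₁ = π σ σ′ perm′
  π₂ = π σ′ σ perm
  π₂π₁ : ∀ a → π₂ (π₁ a) ≡ a
  π₂π₁ a with π₂ (π₁ a) Fin.≟ a
  ... | yes e = e
  ... | no ne = contradiction (trans (π-spec σ′ σ perm (π₁ a)) (π-spec σ σ′ perm′ a)) (perm _ _ ne)

Σℕ-mono-≤ : ∀ n {f g : Fin n → ℕ} → (∀ i → f i ℕ.≤ g i) → Σℕ n f ℕ.≤ Σℕ n g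
Σℕ-mono-≤ zero    h = ℕ.z≤n
Σℕ-mono-≤ (suc n) h = ℕP.+-mono-≤ (h Fin.zero) (Σℕ-mono-≤ n (λ i → h (Fin.suc i)))

Σℕ-mono-< : ∀ n {f g : Fin n → ℕ} → (∀ i → f i ℕ.≤ g i) → ∀ k → f k ℕ.< g k → Σℕ n f ℕ.< Σℕ n g
Σℕ-mono-< (suc n) h Fin.zero    lt = ℕP.+-mono-<-≤ lt (Σℕ-mono-≤ n (λ i → h (Fin.suc i)))
Σℕ-mono-< (suc n) h (Fin.suc k) lt = ℕP.+-mono-≤-< (h Fin.zero) (Σℕ-mono-< n (λ i → h (Fin.suc i)) k lt)

Σℕ-1 : ∀ n → Σℕ n (λ _ → 1) ≡ n
Σℕ-1 zero    = refl
Σℕ-1 (suc n) = cong suc (Σℕ-1 n)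

ind-mono : {P Q : Set} (P? : Dec P) (Q? : Dec Q) → (P → Q) → ind P? ℕ.≤ ind Q?
ind-mono (yes p) Q? f = ℕP.≤-reflexive (sym (ind-yes Q? (f p)))
ind-mono (no _)  Q? f = ℕ.z≤n

-- The position of j is the number of coordinates below v_j.
sorting-exists : ∀ {d} (v : Vec ℚ d) → Distinct v → ∃ λ σ → IsPerm σ × Sorts σ v
sorting-exists {d} v distinct = σ , σ-perm , σ-sorts
  where
  rank : Fin d → ℕ
  rank j = Σℕ d (λ k → ind (lookup v k ℚP.<? lookup v j))
  rank<d : ∀ j → rank j ℕ.< d
  -- Comparison with a sum of `d` ones: the summand at `j` itself is 0.
  rank<d j = subst (rank j ℕ.<_) (Σℕ-1 d) (Σℕ-mono-< d
    (λ k → ind-mono (lookup v k ℚP.<? lookup v j) (yes refl) (λ _ → refl {x = 0})) j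
    (s≤s (ℕP.≤-reflexive (ind-no (lookup v j ℚP.<? lookup v j) (ℚP.<-irrefl refl)))))
  rank-mono : ∀ {j k} → lookup v j ℚ.< lookup v k → rank j ℕ.< rank k
  rank-mono {j} {k} lt = Σℕ-mono-< d
    (λ l → ind-mono (lookup v l ℚP.<? lookup v j) (lookup v l ℚP.<? lookup v k) (λ p → ℚP.<-trans p lt)) j
    (subst₂ ℕ._<_ (sym (ind-no (lookup v j ℚP.<? lookup v j) (ℚP.<-irrefl refl)))
      (sym (ind-yes (lookup v j ℚP.<? lookup v k) lt)) (s≤s ℕ.z≤n))
  ρ : Fin d → Fin d
  ρ j = Fin.fromℕ< (rank<d j)
  toℕ-ρ : ∀ j → toℕ (ρ j) ≡ rank j
  toℕ-ρ j = FinP.toℕ-fromℕ< (rank<d j)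
  ρ-injective : Injective _≡_ _≡_ ρ
  ρ-injective {j} {k} e with j Fin.≟ k
  ... | yes j≡k = j≡k
  ... | no j≢k with ℚP.<-cmp (lookup v j) (lookup v k)
  ...   | tri< lt _ _ = contradiction (trans (sym (toℕ-ρ j)) (trans (cong toℕ e) (toℕ-ρ k))) (ℕP.<⇒≢ (rank-mono lt))
  ...   | tri≈ _ eq _ = contradiction eq (distinct j k j≢k)
  ...   | tri> _ _ gt = contradiction (trans (sym (toℕ-ρ k)) (trans (cong toℕ (sym e)) (toℕ-ρ j))) (ℕP.<⇒≢ (rank-mono gt))
  ρ⁻¹ : Fin d → Fin d
  ρ⁻¹ a = proj₁ (injective⇒surjective ρ ρ-injective a)
  ρρ⁻¹ : ∀ a → ρ (ρ⁻¹ a) ≡ a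
  ρρ⁻¹ a = proj₂ (injective⇒surjective ρ ρ-injective a)
  rank-ρ⁻¹ : ∀ a → rank (ρ⁻¹ a) ≡ toℕ a
  rank-ρ⁻¹ a = trans (sym (toℕ-ρ (ρ⁻¹ a))) (cong toℕ (ρρ⁻¹ a))
  σ : Vec (Fin d) d
  σ = tabulate ρ⁻¹
  σ-perm : IsPerm σ
  σ-perm a b a≢b e = a≢b (trans (sym (ρρ⁻¹ a)) (trans (cong ρ
    (trans (sym (lookup∘tabulate ρ⁻¹ a)) (trans e (lookup∘tabulate ρ⁻¹ b)))) (ρρ⁻¹ b)))
  ρ⁻¹-sorts : ∀ a b → toℕ a ℕ.< toℕ b → lookup v (ρ⁻¹ a) ℚ.< lookup v (ρ⁻¹ b)
  ρ⁻¹-sorts a b a<b with ℚP.<-cmp (lookup v (ρ⁻¹ a)) (lookup v (ρ⁻¹ b))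
  ... | tri< lt _ _ = lt
  ... | tri≈ _ eq _ = contradiction eq (distinct _ _ (λ e → ℕP.<⇒≢ a<b
          (trans (sym (rank-ρ⁻¹ a)) (trans (cong rank e) (rank-ρ⁻¹ b)))))
  ... | tri> _ _ gt = contradiction (subst₂ ℕ._<_ (rank-ρ⁻¹ b) (rank-ρ⁻¹ a) (rank-mono gt)) (ℕP.<-asym a<b)
  σ-sorts : Sorts σ v
  σ-sorts = mkSorts λ a b a<b → subst₂ (λ j k → lookup v j ℚ.< lookup v k)
    (sym (lookup∘tabulate ρ⁻¹ a)) (sym (lookup∘tabulate ρ⁻¹ b)) (ρ⁻¹-sorts a b a<b)

-- Points of the dilated polytope

ℕtoℚ-mono-< : ∀ {m n} → m ℕ.< n → ℕtoℚ m < ℕtoℚ n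
ℕtoℚ-mono-< {m} {n} m<n = ℚP.toℚᵘ-cancel-<
  (ℚᵘP.<-respˡ-≃ (ℚᵘP.≃-sym (ℚP.toℚᵘ-fromℚᵘ (mkℚᵘ (+ m) 0)))
    (ℚᵘP.<-respʳ-≃ (ℚᵘP.≃-sym (ℚP.toℚᵘ-fromℚᵘ (mkℚᵘ (+ n) 0)))
      (ℚᵘ.*<* (subst₂ ℤ._<_ (sym (ℤP.*-identityʳ (+ m))) (sym (ℤP.*-identityʳ (+ n))) (ℤ.+<+ m<n)))))

ℕtoℚ-injective : ∀ {m n} → ℕtoℚ m ≡ ℕtoℚ n → m ≡ n
ℕtoℚ-injective {m} {n} e with ℕP.<-cmp m n
... | tri< lt _ _ = contradiction e (ℚP.<⇒≢ (ℕtoℚ-mono-< lt))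
... | tri≈ _ eq _ = eq
... | tri> _ _ gt = contradiction (sym e) (ℚP.<⇒≢ (ℕtoℚ-mono-< gt))

gap-pos-mono : ∀ {d} (x : Vec ℕ d) {j k} → lookup x j ℕ.< lookup x k → 0ℚ < gap (j , k) (vecℕtoℚ x)
gap-pos-mono x {j} {k} lt = <⇒gap-pos (vecℕtoℚ x) (subst₂ _<_ (sym (lookup-map j ℕtoℚ x)) (sym (lookup-map k ℕtoℚ x)) (ℕtoℚ-mono-< lt))

≡⇒gap-vecℕtoℚ≡0 : ∀ {d} (x : Vec ℕ d) p → lookup x (proj₁ p) ≡ lookup x (proj₂ p) → gap p (vecℕtoℚ x) ≡ 0ℚ
≡⇒gap-vecℕtoℚ≡0 x (j , k) e = ≡⇒gap≡0 (j , k) (vecℕtoℚ x)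
  (trans (lookup-map j ℕtoℚ x) (trans (cong ℕtoℚ e) (sym (lookup-map k ℕtoℚ x))))

gap-vecℕtoℚ≡0⇒≡ : ∀ {d} (x : Vec ℕ d) p → gap p (vecℕtoℚ x) ≡ 0ℚ → lookup x (proj₁ p) ≡ lookup x (proj₂ p)
gap-vecℕtoℚ≡0⇒≡ x (j , k) e = ℕtoℚ-injective
  (trans (sym (lookup-map j ℕtoℚ x)) (trans (gap≡0⇒≡ (j , k) (vecℕtoℚ x) e) (lookup-map k ℕtoℚ x)))

onFlat-resp-gap : ∀ {d} {v y : Vec ℚ d} → (∀ p → gap p v ≡ 0ℚ → gap p y ≡ 0ℚ) → ∀ {S} → OnFlat S v → OnFlat S y
onFlat-resp-gap {v = v} {y} h = All.map (λ {p} e → gap≡0⇒≡ p y (h p (≡⇒gap≡0 p v e)))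

allPairs : ∀ d → List (Pair d)
allPairs d = cartesianProduct (allFin d) (allFin d)

∈-allPairs : ∀ {d} (p : Pair d) → p ∈ allPairs d
∈-allPairs (j , k) = ∈-cartesianProduct⁺ (∈-allFin j) (∈-allFin k)

tied? : ∀ {d} (x : Vec ℕ d) (p : Pair d) → Dec (proj₁ p ≢ proj₂ p × lookup x (proj₁ p) ≡ lookup x (proj₂ p))
tied? x (j , k) = ¬? (j Fin.≟ k) ×-dec (lookup x j ℕP.≟ lookup x k)

-- Pairs (j , j) are left out because their gap vanishes identically, which would leave no region at
-- all. A tie occurs in both orders, which does not affect the number of realised sign vectors.
ties : ∀ {d} → Vec ℕ d → List (Pair d)
ties x = filter (tied? x) (allPairs _)

ties⁺ : ∀ {d} (x : Vec ℕ d) p → proj₁ p ≢ proj₂ p → lookup x (proj₁ p) ≡ lookup x (proj₂ p) → p ∈ ties x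
ties⁺ x p ne e = ∈-filter⁺ (tied? x) (∈-allPairs p) (ne , e)

ties⁻ : ∀ {d} (x : Vec ℕ d) {p} → p ∈ ties x → proj₁ p ≢ proj₂ p × lookup x (proj₁ p) ≡ lookup x (proj₂ p)
ties⁻ x p∈ = proj₂ (∈-filter⁻ (tied? x) {xs = allPairs _} p∈)

gap-asym : ∀ {d} (p : Pair d) v → 0ℚ < gap p v → ¬ 0ℚ < gap (orient false p) v
gap-asym (j , k) v pos neg = ℚP.<-asym (gap-pos⇒< v pos) (gap-pos⇒< v neg)

sign-vector : ∀ {d} (A : List (Pair d)) {v} → All (λ p → gap p v ≢ 0ℚ) A → ∃ λ τ → Sat (orientAll A τ) v
sign-vector []      []            = [] , []
sign-vector (p ∷ A) {v} (ne ∷ nes) = helper (sign-cases ne) (sign-vector A nes)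
  where
  helper : 0ℚ < gap p v ⊎ 0ℚ < - gap p v → (∃ λ τ → Sat (orientAll A τ) v) → ∃ λ τ → Sat (orientAll (p ∷ A) τ) v
  helper (inj₁ pos) (τ , sat) = true ∷ τ , pos ∷ sat
  helper (inj₂ neg) (τ , sat) = false ∷ τ , subst (0ℚ <_) (sym (gap-flip p v)) neg ∷ sat

sign-vector-unique : ∀ {d} (A : List (Pair d)) {τ τ′ v v′} → (∀ p → 0ℚ < gap p v → 0ℚ < gap p v′) →
  Sat (orientAll A τ) v → Sat (orientAll A τ′) v′ → τ ≡ τ′
sign-vector-unique []      {[]}        {[]}         h []       []        = refl
sign-vector-unique (p ∷ A) {true  ∷ _} {true  ∷ _}  h (_ ∷ s)  (_ ∷ s′)  = cong (true ∷_) (sign-vector-unique A h s s′)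
sign-vector-unique (p ∷ A) {false ∷ _} {false ∷ _}  h (_ ∷ s)  (_ ∷ s′)  = cong (false ∷_) (sign-vector-unique A h s s′)
sign-vector-unique (p ∷ A) {true  ∷ _} {false ∷ _} {v′ = v′} h (q ∷ _) (q′ ∷ _) = contradiction q′ (gap-asym p v′ (h p q))
sign-vector-unique (p ∷ A) {false ∷ _} {true  ∷ _} {v′ = v′} h (q ∷ _) (q′ ∷ _) = contradiction (h (orient false p) q) (gap-asym p v′ q′)

sat-agree : ∀ {d} (A : List (Pair d)) {τ v v′ p} → p ∈ A → Sat (orientAll A τ) v → Sat (orientAll A τ) v′ →
  0ℚ < gap p v′ → 0ℚ < gap p v
sat-agree (p ∷ A) {true  ∷ τ} (here refl) (q ∷ _) _        _   = q
sat-agree (p ∷ A) {false ∷ τ} {v′ = v′} (here refl) _ (q′ ∷ _) pos = contradiction q′ (gap-asym p v′ pos)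
sat-agree (_ ∷ A) {_ ∷ τ}     (there p∈)  (_ ∷ s) (_ ∷ s′) pos = sat-agree A p∈ s s′ pos

sat-nonzero : ∀ {d} (A : List (Pair d)) {τ v p} → p ∈ A → Sat (orientAll A τ) v → gap p v ≢ 0ℚ
sat-nonzero (p ∷ A) {true  ∷ τ} (here refl) (q ∷ _) = pos⇒≢0 q
sat-nonzero (p ∷ A) {false ∷ τ} {v} (here refl) (q ∷ _) e = pos⇒≢0 q (trans (gap-flip p v) (cong -_ e))
sat-nonzero (_ ∷ A) {_ ∷ τ}     (there p∈)  (_ ∷ s) = sat-nonzero A p∈ s

sat-resp : ∀ {d} (A : List (Pair d)) {τ v z} → All (λ p → ∀ s → gap (orient s p) v ≡ gap (orient s p) z) A →
  Sat (orientAll A τ) v → Sat (orientAll A τ) z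
sat-resp []      {[]}    []       []      = []
sat-resp (p ∷ A) {s ∷ τ} (e ∷ es) (q ∷ sat) = subst (0ℚ <_) (e s) q ∷ sat-resp A es sat

sorts-resp-gap : ∀ {d} {σ : Vec (Fin d) d} {v y} → (∀ p → 0ℚ < gap p v → 0ℚ < gap p y) → Sorts σ v → Sorts σ y
sorts-resp-gap {σ = σ} {v} {y} h s = mkSorts λ a b a<b →
  gap-pos⇒< y (h (lookup σ a , lookup σ b) (<⇒gap-pos v (increasing s a b a<b)))

sorts-distinct : ∀ {d} {σ : Vec (Fin d) d} {v} → IsPerm σ → Sorts σ v → Distinct v
sorts-distinct {σ = σ} {v} perm s j k j≢k e with perm-surjective σ perm j | perm-surjective σ perm k
... | a , refl | b , refl with ℕP.<-cmp (toℕ a) (toℕ b)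
...   | tri< lt _ _ = ℚP.<⇒≢ (increasing s a b lt) e
...   | tri≈ _ eq _ = j≢k (cong (lookup σ) (FinP.toℕ-injective eq))
...   | tri> _ _ gt = ℚP.<⇒≢ (increasing s b a gt) (sym e)

sorts-agree : ∀ {d} {σ : Vec (Fin d) d} {v v′} → IsPerm σ → Sorts σ v → Sorts σ v′ →
  ∀ p → 0ℚ < gap p v → 0ℚ < gap p v′
sorts-agree {σ = σ} {v} {v′} perm s s′ (j , k) pos with perm-surjective σ perm j | perm-surjective σ perm k
... | a , refl | b , refl = <⇒gap-pos v′ (increasing s′ a b (sorts-reflects s a b (gap-pos⇒< v pos)))

compatible-sorts : ∀ {d} {σ : Vec (Fin d) d} {x v} → IsPerm σ → Compatible x σ → Sorts σ v →
  ∀ j k → lookup x j ℕ.< lookup x k → 0ℚ < gap (j , k) v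
compatible-sorts {σ = σ} {x} {v} perm compat s j k lt with perm-surjective σ perm j | perm-surjective σ perm k
... | a , refl | b , refl with ℕP.<-cmp (toℕ a) (toℕ b)
...   | tri< a<b _ _ = <⇒gap-pos v (increasing s a b a<b)
...   | tri≈ _ eq _ = contradiction (cong (λ c → lookup x (lookup σ c)) (FinP.toℕ-injective eq)) (ℕP.<⇒≢ lt)
...   | tri> _ _ b<a = contradiction (compat b a b<a) (ℕP.<⇒≱ lt)

-- The diagonal point of s, and passing between P°, tP and the direction space

module Centre {d m : ℕ} (F : System d m) (weight : ConstantPositiveWeight F) where
  open Flats F

  -- The reciprocal of the common weight, so that all forms take the value 1 at (r, ..., r).
  r : ℚ
  r = proj₁ (inverse-pos (proj₁ (proj₂ weight)))

  centre : Vec ℚ d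
  centre = lin r ones 0ℚ ones

  centre-in-s : InS F centre
  centre-in-s i = trans (evalF-linear (F i) r ones 0ℚ ones) (trans
    (cong (λ e → r · e + 0ℚ · e) (proj₂ (proj₂ weight) i)) (trans
    (solve 2 (λ r w → r :* w :+ con 0ℚ :* w := r :* w) refl r (proj₁ weight))
    (proj₂ (proj₂ (inverse-pos (proj₁ (proj₂ weight)))))))

  lookup-centre : ∀ j → lookup centre j ≡ r
  lookup-centre j = trans (lookup-lin r ones 0ℚ ones j) (trans
    (cong (λ e → r · e + 0ℚ · e) (lookup-replicate j 1ℚ))
    (solve 1 (λ r → r :* con 1ℚ :+ con 0ℚ :* con 1ℚ := r) refl r))

  centre-pos : ∀ j → 0ℚ < lookup centre j
  centre-pos j = subst (0ℚ <_) (sym (lookup-centre j)) (proj₁ (proj₂ (inverse-pos (proj₁ (proj₂ weight)))))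

  gap-centre : ∀ p → gap p centre ≡ 0ℚ
  gap-centre p = ≡⇒gap≡0 p centre (trans (lookup-centre (proj₁ p)) (sym (lookup-centre (proj₂ p))))

  onFlat-centre : ∀ S → OnFlat S centre
  onFlat-centre = All.universal (λ p → gap≡0⇒≡ p centre (gap-centre p))

  recentre : ℚ → Vec ℚ d → Vec ℚ d
  recentre T x = lin 1ℚ x (- T) centre

  recentre-dir : ∀ {T x} → (∀ i → evalF (F i) x ≡ T) → Dir F (recentre T x)
  recentre-dir {T} {x} h i = trans (evalF-linear (F i) 1ℚ x (- T) centre) (trans
    (cong₂ (λ a b → 1ℚ · a + - T · b) (h i) (centre-in-s i))
    (solve 1 (λ T → con 1ℚ :* T :+ (:- T) :* con 1ℚ := con 0ℚ) refl T))

  gap-recentre : ∀ T x p → gap p (recentre T x) ≡ gap p x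
  gap-recentre T x p = trans (gap-linear p 1ℚ x (- T) centre) (trans
    (cong (λ e → 1ℚ · gap p x + - T · e) (gap-centre p))
    (solve 2 (λ a T → con 1ℚ :* a :+ (:- T) :* con 0ℚ := a) refl (gap p x) T))

  ScaledInto : Vec ℚ d → Vec ℚ d → Set
  ScaledInto v y = ∃ λ ε → 0ℚ < ε × InPo F y × (∀ p → gap p y ≡ ε · gap p v)

  -- Since `ε·K = 1`, the point is `centre + ε·v`. The coordinates of `centre` are positive and
  -- dominate for large `K`; its gaps are zero, so only those of `v` remain, scaled by `ε`.
  shrink : ∀ v → Dir F v → ∃ (ScaledInto v)
  shrink v v∈ =
    let K , 0<K , h    = eventually-all-pos (lookup centre) (lookup v) (allFin d)
        ε , 0<ε , εK≡1 = inverse-pos 0<K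
    in lin (ε · K) centre ε v , ε , 0<ε ,
       ( (λ i → trans (evalF-linear (F i) (ε · K) centre ε v) (trans
           (cong₂ (λ a b → (ε · K) · a + ε · b) (centre-in-s i) (v∈ i)) (trans
           (solve 2 (λ a ε → a :* con 1ℚ :+ ε :* con 0ℚ := a) refl (ε · K) ε) εK≡1)))
       , (λ j → subst (0ℚ <_) (pos-eq ε K j)
           (*-pos 0<ε (All.lookup (h K ℚP.≤-refl) (∈-allFin j) (centre-pos j))))) ,
       (λ p → trans (gap-linear p (ε · K) centre ε v) (trans
           (cong (λ e → (ε · K) · e + ε · gap p v) (gap-centre p))
           (solve 2 (λ a b → a :* con 0ℚ :+ b := b) refl (ε · K) (ε · gap p v))))
    where
    pos-eq : ∀ ε K j → ε · (K · lookup centre j + lookup v j) ≡ lookup (lin (ε · K) centre ε v) j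
    pos-eq ε K j = trans
      (solve 4 (λ ε K c v → ε :* (K :* c :+ v) := (ε :* K) :* c :+ ε :* v) refl ε K (lookup centre j) (lookup v j))
      (sym (lookup-lin (ε · K) centre ε v j))

  scaled-pos : ∀ {v y} → ScaledInto v y → ∀ p → 0ℚ < gap p v → 0ℚ < gap p y
  scaled-pos (ε , 0<ε , _ , eq) p pos = subst (0ℚ <_) (sym (eq p)) (*-pos 0<ε pos)

  scaled-0 : ∀ {v y} → ScaledInto v y → ∀ p → gap p v ≡ 0ℚ → gap p y ≡ 0ℚ
  scaled-0 (ε , 0<ε , _ , eq) p e = trans (eq p) (trans (cong (ε ·_) e) (ℚP.*-zeroʳ ε))

  scaled-0⁻ : ∀ {v y} → ScaledInto v y → ∀ p → gap p y ≡ 0ℚ → gap p v ≡ 0ℚ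
  scaled-0⁻ (ε , 0<ε , _ , eq) p e = *-cancel-0 (pos⇒≢0 0<ε) (trans (sym (eq p)) e)

  -- P° is large enough to detect inclusion of flats: every direction can be shrunk into it around
  -- `centre` with exactly the same ties.
  member⇒sub : ∀ {S S′} → (∀ y → Member F S y → Member F S′ y) → Sub S S′
  member⇒sub h v (v∈ , vS) =
    let y , sc = shrink v v∈
        _ , _ , y∈P , _ = sc
    in onFlat-resp-gap (scaled-0⁻ sc) (proj₂ (h y (y∈P , onFlat-resp-gap (scaled-0 sc) vS)))

  sub⇒member : ∀ {S S′} → Sub S S′ → ∀ y → Member F S y → Member F S′ y
  sub⇒member s y (y∈P , yS) = y∈P ,
    onFlat-resp-gap (λ p e → trans (sym (gap-recentre 1ℚ y p)) e)
      (s (recentre 1ℚ y) (recentre-dir (proj₁ y∈P) ,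
        onFlat-resp-gap (λ p e → trans (gap-recentre 1ℚ y p) e) yS))

  module Dilate (t : ℕ) (x : Vec ℕ d) (x∈tP : InTP F t x) where

    shifted : Vec ℚ d
    shifted = recentre (ℕtoℚ t) (vecℕtoℚ x)

    shifted-dir : Dir F shifted
    shifted-dir = recentre-dir x∈tP

    gap-shifted : ∀ p → gap p shifted ≡ gap p (vecℕtoℚ x)
    gap-shifted = gap-recentre (ℕtoℚ t) (vecℕtoℚ x)

    shifted-tied : ∀ p → lookup x (proj₁ p) ≡ lookup x (proj₂ p) → gap p shifted ≡ 0ℚ
    shifted-tied p e = trans (gap-shifted p) (≡⇒gap-vecℕtoℚ≡0 x p e)

    shifted-pos : ∀ {j k} → lookup x j ℕ.< lookup x k → 0ℚ < gap (j , k) shifted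
    shifted-pos {j} {k} lt = subst (0ℚ <_) (sym (gap-shifted (j , k))) (gap-pos-mono x lt)

    onFlat-shifted : ∀ S → OnFlat S x ⇔ OnFlat S shifted
    onFlat-shifted S = mk⇔
      (All.map (λ {p} e → gap≡0⇒≡ p shifted (shifted-tied p e)))
      (All.map (λ {p} e → gap-vecℕtoℚ≡0⇒≡ x p (trans (sym (gap-shifted p)) (≡⇒gap≡0 p shifted e))))

    ties-onFlat : OnFlat (ties x) shifted
    ties-onFlat = All.tabulate (λ {p} p∈ → gap≡0⇒≡ p shifted (shifted-tied p (proj₂ (ties⁻ x p∈))))

    open Regions F

    module _ {a : ℕ} (pairs : HasCard (CompatPair F t) a) where

      L = proj₁ pairs
      mem = proj₁ (proj₂ (proj₂ pairs))

      _≟x : (l : Vec ℕ d × Vec (Fin d) d) → Dec (proj₁ l ≡ x)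
      l ≟x = ≡-dec ℕP._≟_ (proj₁ l) x

      fibre = filter _≟x L

      fibre⁻ : ∀ {l} → l ∈ fibre → proj₁ l ≡ x × CompatPair F t l
      fibre⁻ {l} l∈ = let l∈L , e = ∈-filter⁻ _≟x {xs = L} l∈ in e , to (mem l) l∈L

      regionList = proj₁ (hasCard-Σ𝔹 (length (ties x)) (realized? [] (ties x)))
      region-unique = proj₁ (proj₂ (hasCard-Σ𝔹 (length (ties x)) (realized? [] (ties x))))
      region-mem = proj₁ (proj₂ (proj₂ (hasCard-Σ𝔹 (length (ties x)) (realized? [] (ties x)))))
      region-length = proj₂ (proj₂ (proj₂ (hasCard-Σ𝔹 (length (ties x)) (realized? [] (ties x)))))

      -- The correspondence between compatible permutations and regions of the ties: some vector is
      -- sorted by `σ` and lies in the region `τ`.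
      Common : Vec ℕ d × Vec (Fin d) d → Vec Bool (length (ties x)) → Set
      Common (_ , σ) τ = ∃ λ v → Sorts σ v × Sat (orientAll (ties x) τ) v

      -- A point realising `σ` has distinct coordinates, so it lies on no tie hyperplane and belongs
      -- to a region.
      region-of : ∀ {l} → l ∈ fibre → ∃ λ τ → τ ∈ regionList × Common l τ
      region-of {_ , σ} l∈ =
        let _ , _ , perm , _ , y , y∈P , y-sorted = fibre⁻ l∈
            v = recentre 1ℚ y
            sorts = sorts-resp-gap {σ = σ} (λ p → subst (0ℚ <_) (sym (gap-recentre 1ℚ y p))) (mkSorts {σ = σ} {y} y-sorted)
            τ , sat = sign-vector (ties x) (All.tabulate (λ {p} p∈ e →
              sorts-distinct {σ = σ} perm sorts _ _ (proj₁ (ties⁻ x p∈)) (gap≡0⇒≡ p v e)))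
        in τ , from (region-mem τ) (v , (recentre-dir (proj₁ y∈P) , []) , sat) , v , sorts , sat

      -- The vector `v` sorted by `σ` is sorted by `σ′` too: where `x` differs, compatibility fixes
      -- the order of the coordinates of `v`, and where `x` is tied, the common region `τ` does.
      common-injectiveˡ : ∀ {l l′ τ} → l ∈ fibre → l′ ∈ fibre → Common l τ → Common l′ τ → l ≡ l′
      common-injectiveˡ {_ , σ} {_ , σ′} l∈ l′∈ (v , s , sat) (v′ , s′ , sat′)
        with fibre⁻ l∈ | fibre⁻ l′∈
      ... | refl , _ , perm , compat , _ | refl , _ , perm′ , compat′ , _ =
        cong (x ,_) (sorts-unique {v = v} perm perm′ s σ′-sorts)
        where
        σ′-sorts : Sorts σ′ v
        σ′-sorts = mkSorts λ a b a<b → gap-pos⇒< v (helper a b a<b (ℕP.m≤n⇒m<n∨m≡n (compat′ a b a<b)))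
          where
          helper : ∀ a b → toℕ a ℕ.< toℕ b → let j = lookup σ′ a ; k = lookup σ′ b in
            lookup x j ℕ.< lookup x k ⊎ lookup x j ≡ lookup x k → 0ℚ < gap (j , k) v
          helper a b a<b (inj₁ lt) = compatible-sorts {x = x} perm compat s _ _ lt
          helper a b a<b (inj₂ eq) = sat-agree (ties x)
            (ties⁺ x (lookup σ′ a , lookup σ′ b) (perm′ a b (λ { refl → ℕP.<-irrefl refl a<b })) eq)
            sat sat′ (<⇒gap-pos v′ (increasing s′ a b a<b))

      -- Perturb x in the direction of a point of the region and sort the result.
      permutation-of : ∀ {τ} → τ ∈ regionList → ∃ λ l → l ∈ fibre × Common l τ
      permutation-of {τ} τ∈ =
        let v , (v∈ , _) , sat = to (region-mem τ) τ∈
            -- Over all pairs, not only the ties: strict inequalities of `x` persist in `z`, while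
            -- tied pairs inherit their order from `v`.
            K , 0<K , persist = perturb (allPairs d) shifted v
            z = lin K shifted 1ℚ v
            z∈ : Dir F z
            z∈ = dir-closed F K shifted 1ℚ v shifted-dir v∈
            z-pos : ∀ {j k} → lookup x j ℕ.< lookup x k → 0ℚ < gap (j , k) z
            z-pos {j} {k} lt = All.lookup persist (∈-allPairs (j , k)) (shifted-pos lt)
            z-sat : Sat (orientAll (ties x) τ) z
            z-sat = sat-resp (ties x) (All.tabulate (λ {p} p∈ → z-tied K v p (proj₂ (ties⁻ x p∈)))) sat
            σ , perm , sorts = sorting-exists z (z-distinct z z-pos z-sat)
            -- The direction `z` is sorted by `σ` but need not lie in P°; shrinking supplies the
            -- realising point.
            y , sc = shrink z z∈
            _ , _ , y∈P , _ = sc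
            l = x , σ
        in l , ∈-filter⁺ _≟x (from (mem l) (x∈tP , perm , z-compat z z-pos σ sorts , y , y∈P ,
                 increasing (sorts-resp-gap {σ = σ} (scaled-pos sc) sorts))) refl ,
           z , sorts , z-sat
        where
        z-tied : ∀ K v p → lookup x (proj₁ p) ≡ lookup x (proj₂ p) → ∀ s →
          gap (orient s p) v ≡ gap (orient s p) (lin K shifted 1ℚ v)
        z-tied K v p e s = sym (trans (gap-linear (orient s p) K shifted 1ℚ v) (trans
          (cong (λ g → K · g + 1ℚ · gap (orient s p) v) (shifted-tied (orient s p) (tied-orient s)))
          (solve 2 (λ K g → K :* con 0ℚ :+ con 1ℚ :* g := g) refl K (gap (orient s p) v))))
          where
          tied-orient : ∀ s → lookup x (proj₁ (orient s p)) ≡ lookup x (proj₂ (orient s p))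
          tied-orient true  = e
          tied-orient false = sym e
        module _ (z : Vec ℚ d) (z-pos : ∀ {j k} → lookup x j ℕ.< lookup x k → 0ℚ < gap (j , k) z) where
          z-distinct : Sat (orientAll (ties x) τ) z → Distinct z
          z-distinct z-sat j k j≢k e with ℕP.<-cmp (lookup x j) (lookup x k)
          ... | tri< lt _ _ = ℚP.<⇒≢ (gap-pos⇒< z (z-pos lt)) e
          ... | tri≈ _ eq _ = sat-nonzero (ties x) (ties⁺ x (j , k) j≢k eq) z-sat (≡⇒gap≡0 (j , k) z e)
          ... | tri> _ _ gt = ℚP.<⇒≢ (gap-pos⇒< z (z-pos gt)) (sym e)
          z-compat : ∀ σ → Sorts σ z → Compatible x σ
          z-compat σ s a b a<b = ℕP.≮⇒≥ (λ gt → ℚP.<-asym (increasing s a b a<b) (gap-pos⇒< z (z-pos gt)))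

      common-injectiveʳ : ∀ {τ τ′ l} → l ∈ fibre → Common l τ → Common l τ′ → τ ≡ τ′
      common-injectiveʳ {l = _ , σ} l∈ (v , s , sat) (v′ , s′ , sat′) =
        let _ , _ , perm , _ = fibre⁻ l∈
        in sign-vector-unique (ties x) (sorts-agree {σ = σ} perm s s′) sat sat′

      fibre-length : length fibre ≡ regions [] (ties x)
      fibre-length = trans (ℕP.≤-antisym
        (length-≤-relation Common (UniqueP.filter⁺ _≟x (proj₁ (proj₂ pairs))) region-of common-injectiveˡ)
        -- Membership in the fibre is made part of the relation because injectivity in this
        -- direction needs `σ` to be a permutation.
        (length-≤-relation (λ τ l → l ∈ fibre × Common l τ) {ys = fibre} region-unique
          (λ τ∈ → let l , l∈ , c = permutation-of τ∈ in l , l∈ , l∈ , c)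
          (λ _ _ (l∈ , c) (_ , c′) → common-injectiveʳ l∈ c c′)))
        region-length

-- The lattice of P° and the two counting formulas

onFlat? : ∀ {d} S (x : Vec ℕ d) → Dec (OnFlat S x)
onFlat? S x = All.all? (λ { (j , k) → lookup x j ℕP.≟ lookup x k }) S

offDiagonal? : ∀ {d} (p : Pair d) → Dec (proj₁ p ≢ proj₂ p)
offDiagonal? (j , k) = ¬? (j Fin.≟ k)

-- A pair (j , j) gives no hyperplane of ℋ, so an arbitrary list has to be cleared of such pairs
-- before it can name a member of 𝓛; its flat stays the same.
proper : ∀ {d} → List (Pair d) → List (Pair d)
proper = filter offDiagonal?

onFlat-proper⁻ : ∀ {d} S (v : Vec ℚ d) → OnFlat (proper S) v → OnFlat S v
onFlat-proper⁻ [] v _ = []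
onFlat-proper⁻ ((j , k) ∷ S) v on with j Fin.≟ k
onFlat-proper⁻ ((j , j) ∷ S) v on       | yes refl = refl ∷ onFlat-proper⁻ S v on
onFlat-proper⁻ ((j , k) ∷ S) v (e ∷ on) | no _     = e ∷ onFlat-proper⁻ S v on

common-value : ∀ {d m} (F : System d m) x → (∀ i i′ → evalF (F i) x ≡ evalF (F i′) x) → ∃ λ T → ∀ i → evalF (F i) x ≡ T
-- Without forms any value serves.
common-value {m = zero}  F x h = 0ℚ , λ ()
common-value {m = suc _} F x h = evalF (F Fin.zero) x , λ i → h i Fin.zero

module Arrangement {d m : ℕ} (F : System d m) (weight : ConstantPositiveWeight F) (magic : MagicLabellingExists F)
  {n : ℕ} (us : Fin n → List (Pair d)) (enum : Enumerates F us) (z : Fin n) (z-same : SameSet F (us z) [])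
  (le : Fin n → Fin n → Bool) (isOrder : IsOrder F us le)
  (μ : Fin n → ℤ) (isMobius : IsMobiusFromBottom le z μ) (t : ℕ) where

  open Flats F
  open Centre F weight
  open Regions F

  -- The magic labelling, moved into V along the diagonal, keeps its coordinates distinct. It
  -- witnesses at once that no hyperplane x_j = x_k with j ≠ k contains s.
  generic : ∃ λ g → Dir F g × (∀ p → proj₁ p ≢ proj₂ p → gap p g ≢ 0ℚ)
  generic =
    let x , _ , distinct , equal = magic
        T , eval≡T = common-value F (vecℕtoℚ x) equal
    in recentre T (vecℕtoℚ x) , recentre-dir eval≡T ,
       λ p ne e → distinct (proj₁ p) (proj₂ p) ne
         (gap-vecℕtoℚ≡0⇒≡ x p (trans (sym (gap-recentre T (vecℕtoℚ x) p)) e))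

  cuts-offDiagonal : ∀ p → proj₁ p ≢ proj₂ p → Cuts [] p
  cuts-offDiagonal p ne = let g , g∈ , distinct = generic in g , (g∈ , []) , distinct p ne

  inH-offDiagonal : ∀ p → proj₁ p ≢ proj₂ p → InH F p
  inH-offDiagonal p ne =
    let g , g∈ , distinct = generic
        y , sc = shrink g g∈
        _ , _ , y∈P , _ = sc
    in y , proj₁ y∈P , λ e → distinct p ne (scaled-0⁻ sc p (≡⇒gap≡0 p y e))

  -- The intersection with P° is never empty, as it contains `centre`.
  isMember-proper : ∀ S → IsMember F (proper S)
  isMember-proper S = All.map (λ {p} → inH-offDiagonal p) (AllP.all-filter offDiagonal? S) ,
    centre , (centre-in-s , centre-pos) , onFlat-centre (proper S)

  idx : List (Pair d) → Fin n
  idx S = proj₁ (proj₁ (proj₂ enum) (proper S) (isMember-proper S))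

  idx-same : ∀ S → SameSet F (proper S) (us (idx S))
  idx-same S = proj₂ (proj₁ (proj₂ enum) (proper S) (isMember-proper S))

  sub-idx : ∀ S → Sub S (us (idx S))
  sub-idx S v (v∈ , vS) = member⇒sub (λ y → to (idx-same S y)) v (v∈ , AllP.filter⁺ offDiagonal? vS)

  idx-sub : ∀ S → Sub (us (idx S)) S
  idx-sub S v v∈ = onFlat-proper⁻ S v (member⇒sub (λ y → from (idx-same S y)) v v∈)

  us-injective : ∀ i j → Sub (us i) (us j) → Sub (us j) (us i) → i ≡ j
  us-injective i j s s′ = proj₂ (proj₂ enum) i j (λ y → mk⇔ (sub⇒member s y) (sub⇒member s′ y))

  us-offDiagonal : ∀ i → All (λ p → proj₁ p ≢ proj₂ p) (us i)
  us-offDiagonal i = All.map (λ { (y , _ , ne) refl → ne refl }) (proj₁ (proj₁ enum i))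

  z-bottom : Sub [] (us z)
  z-bottom = member⇒sub (λ y → from (z-same y))

  le-sub : ∀ v w → le v w ≡ true ⇔ Sub (us w) (us v)
  le-sub v w = mk⇔ (λ l → member⇒sub (to (isOrder v w) l)) (λ s → from (isOrder v w) (sub⇒member s))

  open FlatLattice F us idx sub-idx idx-sub us-injective z z-bottom le le-sub μ isMobius

  us⊆ties : ∀ x i → OnFlat (us i) x → ∀ {p} → p ∈ us i → p ∈ ties x
  us⊆ties x i on {p} p∈ = ties⁺ x p (All.lookup (us-offDiagonal i) p∈) (All.lookup on p∈)

  module _ (x : Vec ℕ d) (x∈tP : InTP F t x) where
    open Dilate t x x∈tP

    on-bottom : OnFlat (us z) x
    on-bottom = from (onFlat-shifted (us z)) (z-bottom shifted (shifted-dir , []))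

    on⇔le : ∀ i → OnFlat (us i) x ⇔ le i (idx (ties x)) ≡ true
    on⇔le i = mk⇔
      (λ on → from (le-sub i (idx (ties x))) (λ v v∈ →
        All.tabulate (λ p∈ → All.lookup (idx-sub (ties x) v v∈) (us⊆ties x i on p∈))))
      (λ l → from (onFlat-shifted (us i)) (to (le-sub i (idx (ties x))) l shifted
        (shifted-dir , sub-idx (ties x) shifted (shifted-dir , ties-onFlat))))

    Σμ-on : Σℤ n (λ i → μ i ℤ.* + ind (onFlat? (us i) x)) ≡ + ind (idx (ties x) Fin.≟ z)
    Σμ-on = trans (Σℤ-cong n (λ i → pointwise i (onFlat? (us i) x) _ refl)) (belowSum-μ (idx (ties x)))
      where
      pointwise : ∀ i (D : Dec (OnFlat (us i) x)) b → le i (idx (ties x)) ≡ b →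
        μ i ℤ.* + ind D ≡ (if b then μ i else + 0)
      pointwise i (yes on) true  e = ℤP.*-identityʳ (μ i)
      pointwise i (no ¬on) true  e = contradiction (from (on⇔le i) e) ¬on
      pointwise i (yes on) false e = contradiction (trans (sym e) (to (on⇔le i) on)) (λ ())
      pointwise i (no ¬on) false e = ℤP.*-zeroʳ (μ i)

    Σ∣μ∣-on : Σℕ n (λ i → ∣ μ i ∣ ℕ.* ind (onFlat? (us i) x)) ≡ regions [] (ties x)
    Σ∣μ∣-on = Σ∣μ∣≡regions shifted shifted-dir (ties x)
      (All.tabulate (λ {p} p∈ → cuts-offDiagonal p (proj₁ (ties⁻ x p∈))))
      ties-onFlat
      (λ w w≢z on → helper w w≢z (us w) refl (from (onFlat-shifted (us w)) on))
      (λ i → onFlat? (us i) x) (λ i → onFlat-shifted (us i))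
      where
      helper : ∀ w → w ≢ z → ∀ S → us w ≡ S → OnFlat (us w) x → ∃ λ p → p ∈ ties x × Vanishes (us w) p
      -- The empty list cuts out the whole space, which is 0̂; for any other list the first pair
      -- will do.
      helper w w≢z []      e on = contradiction
        (us-injective w z (λ v v∈ → z-bottom v (proj₁ v∈ , [])) (λ v _ → subst (λ S → OnFlat S v) (sym e) [])) w≢z
      helper w w≢z (p ∷ S) e on = p , us⊆ties x w on p∈us , λ v v∈ → ≡⇒gap≡0 p v (All.lookup (proj₂ v∈) p∈us)
        where
        p∈us : p ∈ us w
        p∈us = subst (p ∈_) (sym e) (here refl)

  -- If the ties of `x` imposed no condition on V, they would hold at the generic direction, which
  -- has none.
  distinct⇔bottom : ∀ x → Distinct x ⇔ idx (ties x) ≡ z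
  distinct⇔bottom x = mk⇔
    (λ distinct → us-injective (idx (ties x)) z (λ v v∈ → z-bottom v (proj₁ v∈ , []))
      (λ v v∈ → sub-idx (ties x) v (proj₁ v∈ , All.tabulate (λ p∈ →
        let ne , e = ties⁻ x p∈ in contradiction e (distinct _ _ ne)))))
    (λ e j k j≢k eq →
      let g , g∈ , distinct = generic
          on = idx-sub (ties x) g (g∈ , subst (λ i → OnFlat (us i) g) (sym e) (z-bottom g (g∈ , [])))
      in distinct (j , k) j≢k (≡⇒gap≡0 (j , k) g (All.lookup on (ties⁺ x (j , k) j≢k eq))))

  open-count : (Ao : ℕ) → HasCard (MagicPt F t) Ao →
    (E : Fin n → ℕ) → (∀ i → HasCard (PtsOpen F (us i) t) (E i)) → + Ao ≡ Σℤ n (λ i → μ i ℤ.* + E i)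
  open-count Ao cardA E cardE =
    -- Since 0̂ imposes no tie, the list behind `E z` holds all positive integer points of tP, and
    -- every other count becomes a sum over it.
    let X , uX , mem , _ = cardE z in begin
    + Ao
      ≡⟨ cong +_ (hasCard-Σ {P = MagicPt F t} (λ x → idx (ties x) Fin.≟ z) uX (λ x → mk⇔
           (λ (x∈ , pos , distinct) → from (mem x) (x∈ , pos , on-bottom x x∈) , to (distinct⇔bottom x) distinct)
           (λ (x∈X , e) → let x∈ , pos , _ = to (mem x) x∈X in x∈ , pos , from (distinct⇔bottom x) e)) cardA) ⟩
    + Σₗ X (λ x → ind (idx (ties x) Fin.≟ z))
      ≡⟨ sym (Σℤ-Σₗ n μ (λ i x → ind (onFlat? (us i) x)) _ X (λ {x} x∈X → Σμ-on x (proj₁ (to (mem x) x∈X)))) ⟩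
    Σℤ n (λ i → μ i ℤ.* + Σₗ X (λ x → ind (onFlat? (us i) x)))
      ≡⟨ Σℤ-cong n (λ i → cong (λ k → μ i ℤ.* + k) (sym (hasCard-Σ {P = PtsOpen F (us i) t} (onFlat? (us i)) uX (λ x → mk⇔
           (λ (x∈ , pos , on) → from (mem x) (x∈ , pos , on-bottom x x∈) , on)
           (λ (x∈X , on) → let x∈ , pos , _ = to (mem x) x∈X in x∈ , pos , on)) (cardE i)))) ⟩
    Σℤ n (λ i → μ i ℤ.* + E i) ∎
    where open ≡-Reasoning

  closed-count : (A : ℕ) → HasCard (CompatPair F t) A →
    (E : Fin n → ℕ) → (∀ i → HasCard (PtsClosed F (us i) t) (E i)) → A ≡ Σℕ n (λ i → ∣ μ i ∣ ℕ.* E i)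
  closed-count A cardA@(L , uL , memL , length-L) E cardE =
    let X , uX , mem , _ = cardE z in begin
    A
      ≡⟨ sym length-L ⟩
    length L
      ≡⟨ length-by-fibres (≡-dec ℕP._≟_) proj₁ uX L (λ {l} l∈ →
           let x∈ , _ = to (memL l) l∈ in from (mem (proj₁ l)) (x∈ , on-bottom (proj₁ l) x∈)) ⟩
    Σₗ X (λ x → length (filter (λ l → ≡-dec ℕP._≟_ (proj₁ l) x) L))
      ≡⟨ Σₗ-cong X (λ {x} x∈X → let x∈ , _ = to (mem x) x∈X in
           trans (Dilate.fibre-length t x x∈ cardA) (sym (Σ∣μ∣-on x x∈))) ⟩
    Σₗ X (λ x → Σℕ n (λ i → ∣ μ i ∣ ℕ.* ind (onFlat? (us i) x)))
      ≡⟨ sym (Σℕ-Σₗ-swap n (λ i → ∣ μ i ∣) (λ i x → ind (onFlat? (us i) x)) X) ⟩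
    Σℕ n (λ i → ∣ μ i ∣ ℕ.* Σₗ X (λ x → ind (onFlat? (us i) x)))
      ≡⟨ Σℕ-cong n (λ i → cong (∣ μ i ∣ ℕ.*_) (sym (hasCard-Σ {P = PtsClosed F (us i) t} (onFlat? (us i)) uX (λ x → mk⇔
           (λ (x∈ , on) → from (mem x) (x∈ , on-bottom x x∈) , on)
           (λ (x∈X , on) → proj₁ (to (mem x) x∈X) , on)) (cardE i)))) ⟩
    Σℕ n (λ i → ∣ μ i ∣ ℕ.* E i) ∎
    where open ≡-Reasoning

theorem3p17 :
  (d m : ℕ) (F : System d m)
  → ConstantPositiveWeight F
  → EveryVariableAppears F
  → Consistent F
  → MagicLabellingExists F
  → (n : ℕ) (us : Fin n → List (Pair d)) → Enumerates F us
  → (z : Fin n) → SameSet F (us z) []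
  → (le : Fin n → Fin n → Bool) → IsOrder F us le
  → (μ : Fin n → ℤ) → IsMobiusFromBottom le z μ
  → (t : ℕ) → 1 ≤ t
  → ((Ao : ℕ) → HasCard (MagicPt F t) Ao
      → (E : Fin n → ℕ) → (∀ i → HasCard (PtsOpen F (us i) t) (E i))
      → + Ao ≡ Σℤ n (λ i → μ i * + E i))
    × ((A : ℕ) → HasCard (CompatPair F t) A
      → (E : Fin n → ℕ) → (∀ i → HasCard (PtsClosed F (us i) t) (E i))
      → A ≡ Σℕ n (λ i → ∣ μ i ∣ ℕ.* E i))
theorem3p17 d m F weight _ _ magic n us enum z z-same le isOrder μ isMobius t _ = open-count , closed-count
  where open Arrangement F weight magic us enum z z-same le isOrder μ isMobius t
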